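{- (1) There exists an LS*$(1,2;2,(3,\{3,8\}),v)$ for every $v\equiv 8\pmod{12}$. (2) There exists an LS*$(1,2;2,(3,\{3,14,26,50,98\}),v)$ for every $v\equiv 2\pmod{12}$.
   Context: For a set $K$ of positive integers, an S$(\lambda;2,K,v)$ is a pair $(X,\mathcal{B})$ with $|X|=v$ and $\mathcal{B}$ a multiset of subsets of $X$ (blocks) with sizes in $K$ such that every 2-subset of $X$ lies in exactly $\lambda$ blocks (counted with multiplicity). An S$(3,K,v)$ is a pair $(X,\mathcal{B})$ with $\mathcal{B}$ a set of subsets of $X$ with sizes in $K$ such that every 3-subset of $X$ lies in exactly one block. An LS$(1,\lambda;2,(3,K),v)$ is a collection $(X,\mathcal{B}_r)_{r\in R}$ of S$(\lambda;2,K,v)$ on a common point set $X$ such that $(X,\bigcup_{r\in R}\mathcal{B}_r)$ (ordinary set union, not multiset union) is an S$(3,K,v)$ and each block $B$ of this union appears exactly $|B|-2$ times in the multiset $\{B: B\in\mathcal{B}_r, r\in R\}$. An LS*$(1,\lambda;2,(3,K),v)$ is such an LS with the additional property that for every $r\in R$ and every $B\in\mathcal{B}_r$ with $|B|\ge 4$, $B$ appears exactly $\lambda$ times in $\mathcal{B}_r$. -}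

module Defs where

open import Data.Nat using (ℕ; _≤_; _∸_)
open import Data.Fin using (Fin)
open import Data.Fin.Subset using (Subset; _∈_; ∣_∣)
open import Data.Fin.Subset.Properties using (_∈?_)
open import Data.Bool using () renaming (_≟_ to _≟ᵇ_)
open import Data.Vec.Properties using (≡-dec)
open import Data.List using (List; length; filter; map; allFin)
open import Data.Nat.ListAction using (sum)
open import Data.List.Membership.Propositional using () renaming (_∈_ to _∈ₗ_)
open import Data.Product using (Σ; ∃; _×_)
open import Relation.Nullary using (¬_)
open import Relation.Nullary.Decidable using (_×-dec_)
open import Relation.Binary.PropositionalEquality using (_≡_)

Block : ℕ → Set
Block v = Subset v

_≟B_ : ∀ {v} (A B : Block v) → Relation.Nullary.Dec (A ≡ B)
_≟B_ = ≡-dec _≟ᵇ_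

mult : ∀ {v} → Block v → List (Block v) → ℕ
mult B bs = length (filter (B ≟B_) bs)

pairCount : ∀ {v} → Fin v → Fin v → List (Block v) → ℕ
pairCount x y bs = length (filter (λ B → (x ∈? B) ×-dec (y ∈? B)) bs)

IsS2 : (λ' : ℕ) (K : List ℕ) (v : ℕ) → List (Block v) → Set
IsS2 λ' K v bs =
  (∀ B → B ∈ₗ bs → ∣ B ∣ ∈ₗ K) ×
  (∀ (x y : Fin v) → ¬ (x ≡ y) → pairCount x y bs ≡ λ')

InUnion : ∀ {v m} → (Fin m → List (Block v)) → Block v → Set
InUnion {m = m} ℬ B = ∃ λ (r : Fin m) → B ∈ₗ ℬ r

IsLS : (λ' : ℕ) (K : List ℕ) (v m : ℕ) → (Fin m → List (Block v)) → Set
IsLS λ' K v m ℬ =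
  (∀ r → IsS2 λ' K v (ℬ r)) ×
  -- the set union is an S(3,K,v): block sizes in K (implied above) and
  -- every 3-subset lies in exactly one block of the union
  ((∀ (x y z : Fin v) → ¬ (x ≡ y) → ¬ (x ≡ z) → ¬ (y ≡ z) →
      (∃ λ B → InUnion ℬ B × x ∈ B × y ∈ B × z ∈ B) ×
      (∀ B B′ → InUnion ℬ B → x ∈ B → y ∈ B → z ∈ B →
                InUnion ℬ B′ → x ∈ B′ → y ∈ B′ → z ∈ B′ → B ≡ B′)) ×
  (∀ B → InUnion ℬ B → sum (map (λ r → mult B (ℬ r)) (allFin m)) ≡ ∣ B ∣ ∸ 2))

IsLSStar : (λ' : ℕ) (K : List ℕ) (v m : ℕ) → (Fin m → List (Block v)) → Set
IsLSStar λ' K v m ℬ =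
  IsLS λ' K v m ℬ ×
  (∀ r B → B ∈ₗ ℬ r → 4 ≤ ∣ B ∣ → mult B (ℬ r) ≡ λ')

LSStar : (λ' : ℕ) (K : List ℕ) (v : ℕ) → Set
LSStar λ' K v = Σ ℕ λ m → Σ (Fin m → List (Block v)) λ ℬ → IsLSStar λ' K v m ℬ

{-# OPTIONS --safe #-}

-- All large blocks contain two points ∞₀, ∞₁ and cut the remaining points into groups of a common size h (6 in the
-- first case, 12 or 24 in the second).  It suffices to distribute the triples that do not lie in a large block over
-- systems, h / 2 for each group, so that in a system of the group G a pair lies in no triple if it lies in
-- G ∪ {∞₀, ∞₁}, and in exactly two triples otherwise; the large block on G is then added twice.
--
-- Such a distribution comes from a symmetric F : V³ → R on the finite points V for which F P Q S = r has exactly two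
-- solutions S for given P, Q, r.  Triples of distinct points go to the system F P Q S, and F P P Q = r, an arc P → Q,
-- gives the block {∞, P, Q} of r with ∞ chosen by a colouring c of the arcs.  It works if c Q P ≠ c P Q and if, in each
-- system, the two arcs leaving a point, and likewise the two arcs entering it, differ in colour.
--
-- F is the product of a small cube f on N × ℤ₂ with a + b + c + majority in ℤₖ.  The small cubes are
-- (x + y + z) / 3 in ℤₘ with m coprime to 6, a cube on 𝔽₄ × ℤ₂, and a cube on ℤ₃ × ℤ₃ whose groups are three parallel
-- lines.  Taking k large and refining the groups recursively multiplies the number of groups by m, 4 and 3.

module Submission where

open import Defs
open import Data.Nat using (ℕ; _%_)
open import Data.List using (_∷_; [])
open import Data.Product using (_×_)
open import Relation.Binary.PropositionalEquality using (_≡_)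

open import Data.Bool using (Bool; true; false; not; _∧_; _∨_; _xor_; if_then_else_) renaming (T to IsTrue)
open import Data.Bool.Properties using (¬-not; not-¬; not-involutive; xor-comm) renaming (_≟_ to _≟ᵇ_)
open import Data.Empty using (⊥; ⊥-elim)
open import Data.Fin using (Fin; zero; suc; toℕ; fromℕ<; inject≤; combine; remQuot)
open import Data.Fin.Properties
  using (any?; toℕ-fromℕ<; toℕ-injective; toℕ<n; *↔×; +↔⊎; 2↔Bool; combine-injectiveʳ; remQuot-combine;
         combine-remQuot)
  renaming (_≟_ to _≟ᶠ_)
import Data.Integer as ℤ
open import Data.Integer.DivMod using (n%ℕd<d; a≡a%ℕn+[a/ℕn]*n)
import Data.Integer.Properties as ℤₚ
import Data.Integer.Tactic.RingSolver as ℤ-Solver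
open import Data.Nat as ℕ using (suc; zero; NonZero; _<_; _≤_; _∸_; _<ᵇ_; ⌊_/2⌋; s≤s)
open import Data.Nat.DivMod using (_mod_; m≡m%n+[m/n]*n; m%n<n)
open import Data.Nat.Induction using (<-rec)
import Data.Nat.Properties as ℕₚ
open import Data.Product using (∃; ∃₂; ∃!; _,_; proj₁; proj₂; map₂)
open import Data.Product.Algebra using (×-assoc)
open import Data.Product.Function.NonDependent.Propositional using (_×-↔_)
open import Data.Product.Properties using (≡-dec)
open import Data.Sum using (_⊎_; inj₁; inj₂; [_,_]′) renaming (map to map⊎)
open import Data.Sum.Function.Propositional using (_⊎-↔_)
open import Data.Sum.Properties using (inj₁-injective; inj₂-injective)
open import Data.Unit using (⊤; tt)
open import Function using (_∘_; id; it; case_of_; _↔_; Inverse; mk↔ₛ′)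
open import Function.Properties.Inverse using (↔-refl; ↔-sym; ↔-trans)
open import Level using (0ℓ)
open import Relation.Binary.Definitions using (DecidableEquality; tri<; tri≈; tri>)
open import Relation.Binary.PropositionalEquality
  using (_≢_; refl; sym; trans; cong; cong₂; subst; ≢-sym; module ≡-Reasoning)
open import Relation.Nullary using (¬_; Dec; yes; no)
open import Relation.Nullary.Decidable
  using (_×-dec_; _⊎-dec_; _→-dec_; ¬?; map′; decidable-stable; from-yes)
open import Relation.Unary using (Pred; Decidable)

-- Preliminaries and triple systems with holes.

to-injective : ∀ {A B : Set} (f : A ↔ B) {x y} → Inverse.to f x ≡ Inverse.to f y → x ≡ y
to-injective f {x} {y} eq =
  trans (sym (Inverse.strictlyInverseʳ f x)) (trans (cong (Inverse.from f) eq) (Inverse.strictlyInverseʳ f y))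

bool-pigeonhole : ∀ {a b c : Bool} → a ≢ b → a ≢ c → b ≢ c → ⊥
bool-pigeonhole a≢b a≢c b≢c = a≢c (trans (¬-not a≢b) (sym (¬-not (≢-sym b≢c))))

Two : {A : Set} → Pred A 0ℓ → Set
Two {A} P = ∃₂ λ (a b : A) → a ≢ b × P a × P b × (∀ c → P c → c ≡ a ⊎ c ≡ b)

-- T r x y z says that {x, y, z} is a block of system r; On l is the large block l, and the large block On (hole r)
-- is the one that completes system r.
record HoleSystem {X R Λ : Set} (On : Λ → X → Set) (hole : R → Λ) : Set₁ where
  Coplanar : X → X → X → Set
  Coplanar x y z = ∃ λ l → On l x × On l y × On l z
  field
    T           : R → X → X → X → Set
    T?          : ∀ r x y z → Dec (T r x y z)
    swap₁₂      : ∀ {r x y z} → T r x y z → T r y x z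
    swap₂₃      : ∀ {r x y z} → T r x y z → T r x z y
    distinct    : ∀ {r x y z} → T r x y z → x ≢ y
    transversal : ∀ {r x y z} → T r x y z → ¬ Coplanar x y z
    functional  : ∀ {r s x y z} → T r x y z → T s x y z → r ≡ s
    total       : ∀ {x y z} → x ≢ y → x ≢ z → y ≢ z → Coplanar x y z ⊎ ∃ λ r → T r x y z
    avoid       : ∀ {r x y z} → On (hole r) x → On (hole r) y → ¬ T r x y z
    two         : ∀ {r x y} → x ≢ y → ¬ (On (hole r) x × On (hole r) y) → Two (T r x y)

Two-map : {A B : Set} {P : Pred A 0ℓ} {Q : Pred B 0ℓ} (f : A → B) →
          (∀ {a b} → P a → P b → f a ≡ f b → a ≡ b) → (∀ {a} → P a → Q (f a)) →
          (∀ {b} → Q b → ∃ λ a → P a × b ≡ f a) → Two P → Two Q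
Two-map f inj sound cover (a , b , a≢b , p , q , complete) =
  f a , f b , a≢b ∘ inj p q , sound p , sound q , λ c t → case cover t of λ
    { (d , s , refl) → map⊎ (cong f) (cong f) (complete d s) }

Pt : Set → Set
Pt V = Bool ⊎ V

pattern ∞ b = inj₁ b
pattern pt P = inj₂ P

On : {Λ V : Set} → (V → Λ) → Λ → Pt V → Set
On line l (∞ _)  = ⊤
On line l (pt P) = line P ≡ l

-- Transport of hole systems along bijections.

module _ {X R Λ X′ R′ Λ′ : Set} {On : Λ → X → Set} {hole : R → Λ} {On′ : Λ′ → X′ → Set} {hole′ : R′ → Λ′}
  (φ : X′ ↔ X) (ψ : R′ ↔ R) (χ : Λ′ ↔ Λ)
  (on⁺ : ∀ {l x} → On′ l x → On (Inverse.to χ l) (Inverse.to φ x))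
  (on⁻ : ∀ {l x} → On (Inverse.to χ l) (Inverse.to φ x) → On′ l x)
  (hole-to : ∀ r → hole (Inverse.to ψ r) ≡ Inverse.to χ (hole′ r)) where

  private
    module φ = Inverse φ
    module ψ = Inverse ψ
    module χ = Inverse χ

    on-hole : ∀ {r x} → On′ (hole′ r) x → On (hole (ψ.to r)) (φ.to x)
    on-hole {r} {x} = subst (λ l → On l (φ.to x)) (sym (hole-to r)) ∘ on⁺

    on-hole⁻ : ∀ {r x} → On (hole (ψ.to r)) (φ.to x) → On′ (hole′ r) x
    on-hole⁻ {r} {x} = on⁻ ∘ subst (λ l → On l (φ.to x)) (hole-to r)

    on-from : ∀ {l x} → On l (φ.to x) → On′ (χ.from l) x
    on-from {l} {x} = on⁻ ∘ subst (λ l → On l (φ.to x)) (sym (χ.strictlyInverseˡ l))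

  transport : HoleSystem On hole → HoleSystem On′ hole′
  transport H = record
    { T           = λ r x y z → T (ψ.to r) (φ.to x) (φ.to y) (φ.to z)
    ; T?          = λ r x y z → T? (ψ.to r) (φ.to x) (φ.to y) (φ.to z)
    ; swap₁₂      = swap₁₂
    ; swap₂₃      = swap₂₃
    ; distinct    = λ t x≡y → distinct t (cong φ.to x≡y)
    ; transversal = λ { t (l , onx , ony , onz) → transversal t (χ.to l , on⁺ onx , on⁺ ony , on⁺ onz) }
    ; functional  = λ t t′ → to-injective ψ (functional t t′)
    ; total       = λ x≢y x≢z y≢z → map⊎
        (λ { (l , onx , ony , onz) → χ.from l , on-from onx , on-from ony , on-from onz })
        (λ { (r , t) → ψ.from r , subst (λ s → T s _ _ _) (sym (ψ.strictlyInverseˡ r)) t })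
        (total (x≢y ∘ to-injective φ) (x≢z ∘ to-injective φ) (y≢z ∘ to-injective φ))
    ; avoid       = λ onx ony → avoid (on-hole onx) (on-hole ony)
    ; two         = λ x≢y ¬on → Two-map φ.from
        (λ _ _ → to-injective (↔-sym φ))
        (λ {a} t → subst (T _ _ _) (sym (φ.strictlyInverseˡ a)) t)
        (λ {b} t → φ.to b , t , sym (φ.strictlyInverseʳ b))
        (two (x≢y ∘ to-injective φ) (λ { (onx , ony) → ¬on (on-hole⁻ onx , on-hole⁻ ony) }))
    }
    where open HoleSystem H

-- Filling the lines of a hole system with smaller hole systems.

module _ {Λ₁ Λ₂ V R : Set} (_≟_ : DecidableEquality Λ₁) {line : V → Λ₂} {hole : R → Λ₂} where

  private
    On₁ : Λ₁ → Pt (Λ₁ × V) → Set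
    On₁ = On proj₁

    On₁₂ : Λ₁ × Λ₂ → Pt (Λ₁ × V) → Set
    On₁₂ = On (map₂ line)

    forget : Pt (Λ₁ × V) → Pt V
    forget (∞ b)        = ∞ b
    forget (pt (_ , P)) = pt P

    lift : Λ₁ → Pt V → Pt (Λ₁ × V)
    lift l (∞ b)  = ∞ b
    lift l (pt P) = pt (l , P)

    on₁ : ∀ {l k} x → On₁₂ (l , k) x → On₁ l x
    on₁ (∞ _)  _    = tt
    on₁ (pt _) refl = refl

    on₂ : ∀ {l k} x → On₁₂ (l , k) x → On line k (forget x)
    on₂ (∞ _)  _    = tt
    on₂ (pt _) refl = refl

    on₁₂ : ∀ {l k} x → On₁ l x → On line k (forget x) → On₁₂ (l , k) x
    on₁₂ (∞ _)  _    _    = tt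
    on₁₂ (pt _) refl refl = refl

    lift-forget : ∀ {l} x → On₁ l x → x ≡ lift l (forget x)
    lift-forget (∞ _)  _    = refl
    lift-forget (pt _) refl = refl

    forget-lift : ∀ l x → forget (lift l x) ≡ x
    forget-lift l (∞ _)  = refl
    forget-lift l (pt _) = refl

    on-lift : ∀ l x → On₁ l (lift l x)
    on-lift l (∞ _)  = tt
    on-lift l (pt _) = refl

    forget-injective : ∀ {l x y} → On₁ l x → On₁ l y → forget x ≡ forget y → x ≡ y
    forget-injective {l} {x} {y} onx ony eq =
      trans (lift-forget x onx) (trans (cong (lift l) eq) (sym (lift-forget y ony)))

    on₁? : ∀ l x → Dec (On₁ l x)
    on₁? l (∞ _)        = yes tt
    on₁? l (pt (k , _)) = k ≟ l

  -- Each line of `H₁`, together with the points at infinity, carries a copy of `H₂`. In the system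
  -- `(l , r)` a pair inside the line `l` is avoided by `H₁` and takes its triples from the copy of
  -- `H₂` on `l`; any other pair takes them from `H₁` alone.
  compose : HoleSystem On₁ (proj₁ {B = λ _ → R}) → HoleSystem (On line) hole → HoleSystem On₁₂ (map₂ hole)
  compose H₁ H₂ = record
    { T           = T
    ; T?          = λ { (l , r) x y z → T₁? (l , r) x y z ⊎-dec
                          ((on₁? l x ×-dec on₁? l y ×-dec on₁? l z) ×-dec T₂? r (forget x) (forget y) (forget z)) }
    ; swap₁₂      = λ { (inj₁ t) → inj₁ (swap₁₂ H₁ t)
                      ; (inj₂ ((onx , ony , onz) , t)) → inj₂ ((ony , onx , onz) , swap₁₂ H₂ t) }
    ; swap₂₃      = λ { (inj₁ t) → inj₁ (swap₂₃ H₁ t)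
                      ; (inj₂ ((onx , ony , onz) , t)) → inj₂ ((onx , onz , ony) , swap₂₃ H₂ t) }
    ; distinct    = λ { (inj₁ t) → distinct H₁ t ; (inj₂ (_ , t)) → distinct H₂ t ∘ cong forget }
    ; transversal = λ { (inj₁ t) ((l , _) , onx , ony , onz) → transversal H₁ t (l , on₁ _ onx , on₁ _ ony , on₁ _ onz)
                      ; (inj₂ (_ , t)) ((_ , k) , onx , ony , onz) →
                          transversal H₂ t (k , on₂ _ onx , on₂ _ ony , on₂ _ onz) }
    ; functional  = functional₁₂
    ; total       = total₁₂
    ; avoid       = λ { onx ony (inj₁ t) → avoid H₁ (on₁ _ onx) (on₁ _ ony) t
                      ; onx ony (inj₂ (_ , t)) → avoid H₂ (on₂ _ onx) (on₂ _ ony) t }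
    ; two         = two₁₂
    }
    where
    open HoleSystem hiding (T; T?)
    open HoleSystem H₁ using () renaming (T to T₁; T? to T₁?)
    open HoleSystem H₂ using () renaming (T to T₂; T? to T₂?)

    T : Λ₁ × R → Pt (Λ₁ × V) → Pt (Λ₁ × V) → Pt (Λ₁ × V) → Set
    T (l , r) x y z = T₁ (l , r) x y z ⊎ ((On₁ l x × On₁ l y × On₁ l z) × T₂ r (forget x) (forget y) (forget z))

    -- Three points at infinity lie on every line, so a triple of `H₂` has a finite point, and that
    -- point determines the line.
    same-line : ∀ {l l′ r} x y z → On₁ l x × On₁ l y × On₁ l z → On₁ l′ x × On₁ l′ y × On₁ l′ z →
                T₂ r (forget x) (forget y) (forget z) → l ≡ l′
    same-line (pt _) _      _      (refl , _ , _) (refl , _ , _) _ = refl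
    same-line (∞ _)  (pt _) _      (_ , refl , _) (_ , refl , _) _ = refl
    same-line (∞ _)  (∞ _)  (pt _) (_ , _ , refl) (_ , _ , refl) _ = refl
    same-line {r = r} (∞ _) (∞ _) (∞ _) _ _ t = ⊥-elim (transversal H₂ t (hole r , tt , tt , tt))

    functional₁₂ : ∀ {r s x y z} → T r x y z → T s x y z → r ≡ s
    functional₁₂ (inj₁ t) (inj₁ t′) = functional H₁ t t′
    functional₁₂ {s = l , _} (inj₁ t) (inj₂ (on , _)) = ⊥-elim (transversal H₁ t (l , on))
    functional₁₂ {r = l , _} (inj₂ (on , _)) (inj₁ t) = ⊥-elim (transversal H₁ t (l , on))
    functional₁₂ {x = x} {y} {z} (inj₂ (on , t)) (inj₂ (on′ , t′)) =
      cong₂ _,_ (same-line x y z on on′ t) (functional H₂ t t′)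

    total₁₂ : ∀ {x y z} → x ≢ y → x ≢ z → y ≢ z →
              (∃ λ l → On₁₂ l x × On₁₂ l y × On₁₂ l z) ⊎ ∃ λ r → T r x y z
    total₁₂ {x} {y} {z} x≢y x≢z y≢z with total H₁ x≢y x≢z y≢z
    ... | inj₂ (r , t) = inj₂ (r , inj₁ t)
    ... | inj₁ (l , onx , ony , onz) = map⊎
      (λ { (k , onx′ , ony′ , onz′) → (l , k) , on₁₂ x onx onx′ , on₁₂ y ony ony′ , on₁₂ z onz onz′ })
      (λ { (r , t) → (l , r) , inj₂ ((onx , ony , onz) , t) })
      (total H₂ (x≢y ∘ forget-injective onx ony) (x≢z ∘ forget-injective onx onz) (y≢z ∘ forget-injective ony onz))

    two₁₂ : ∀ {r x y} → x ≢ y → ¬ (On₁₂ (map₂ hole r) x × On₁₂ (map₂ hole r) y) → Two (T r x y)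
    two₁₂ {l , r} {x} {y} x≢y ¬on with on₁? l x ×-dec on₁? l y
    ... | yes (onx , ony) = Two-map (lift l)
      (λ {a} {b} _ _ eq → trans (sym (forget-lift l a)) (trans (cong forget eq) (forget-lift l b)))
      (λ {a} t → inj₂ ((onx , ony , on-lift l a) , subst (T₂ r _ _) (sym (forget-lift l a)) t))
      (λ { (inj₁ t) → ⊥-elim (avoid H₁ onx ony t)
         ; {b} (inj₂ ((_ , _ , onb) , t)) → forget b , t , lift-forget b onb })
      (two H₂ (x≢y ∘ forget-injective onx ony) λ { (onx′ , ony′) → ¬on (on₁₂ x onx onx′ , on₁₂ y ony ony′) })
    ... | no ¬on₁ = Two-map id (λ _ _ → id) inj₁
      (λ { (inj₁ t) → _ , t , refl ; (inj₂ ((onx , ony , _) , _)) → ⊥-elim (¬on₁ (onx , ony)) })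
      (two H₁ x≢y ¬on₁)

-- Hole systems from coloured cubes.

-- `closed` sends the triples inside a line to systems whose hole is that line, so that discarding
-- them affects no other system. Conversely, by `closed⁻` and `apart`, a triple with two points in
-- the hole of its system, or an arc with one end there, lies wholly in the hole.
record ColouredCube {Λ V R : Set} (line : V → Λ) (hole : R → Λ) : Set where
  field
    F       : V → V → V → R
    c       : V → V → Bool
    F-swap₁₂ : ∀ P Q S → F P Q S ≡ F Q P S
    F-swap₂₃ : ∀ P Q S → F P Q S ≡ F P S Q
    F-two    : ∀ P Q r → Two (λ S → F P Q S ≡ r)
    closed   : ∀ {P Q S} → line P ≡ line Q → line P ≡ line S → hole (F P Q S) ≡ line P
    closed⁻  : ∀ {P Q S} → line P ≡ line Q → hole (F P Q S) ≡ line P → line S ≡ line P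
    apart    : ∀ {P Q} → hole (F P P Q) ≡ line Q → line P ≡ line Q
    out      : ∀ {P r} → line P ≢ hole r → ∀ b → ∃! _≡_ λ Q → F P P Q ≡ r × c P Q ≡ b
    into     : ∀ {Q r} → line Q ≢ hole r → ∀ b → ∃! _≡_ λ P → F P P Q ≡ r × c P Q ≡ b
    c-anti   : ∀ {P Q} → line P ≢ line Q → c Q P ≡ not (c P Q)

module _ {Λ V R : Set} {line : V → Λ} {hole : R → Λ}
  (_≟ˡ_ : DecidableEquality Λ) (_≟ᵖ_ : DecidableEquality V) (_≟ʳ_ : DecidableEquality R)
  (C : ColouredCube line hole) where
  open ColouredCube C

  private
    -- By `c-anti` exactly one of the arcs P → Q and Q → P has colour `b`; the block on `∞ b`, P and
    -- Q belongs to the system of that arc.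
    Infinite : R → Bool → V → V → Set
    Infinite r b P Q = line P ≢ line Q × ((F P P Q ≡ r × c P Q ≡ b) ⊎ (F Q Q P ≡ r × c Q P ≡ b))

    Finite : R → V → V → V → Set
    Finite r P Q S = P ≢ Q × P ≢ S × Q ≢ S × ¬ (line P ≡ line Q × line P ≡ line S) × F P Q S ≡ r

    T : R → Pt V → Pt V → Pt V → Set
    T r (pt P) (pt Q) (pt S) = Finite r P Q S
    T r (∞ b)  (pt P) (pt Q) = Infinite r b P Q
    T r (pt P) (∞ b)  (pt Q) = Infinite r b P Q
    T r (pt P) (pt Q) (∞ b)  = Infinite r b P Q
    T r (∞ _)  (∞ _)  _      = ⊥
    T r (∞ _)  (pt _) (∞ _)  = ⊥
    T r (pt _) (∞ _)  (∞ _)  = ⊥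

    inf? : ∀ r b P Q → Dec (Infinite r b P Q)
    inf? r b P Q = ¬? (line P ≟ˡ line Q) ×-dec
                   (((F P P Q ≟ʳ r) ×-dec (c P Q ≟ᵇ b)) ⊎-dec ((F Q Q P ≟ʳ r) ×-dec (c Q P ≟ᵇ b)))

    T? : ∀ r x y z → Dec (T r x y z)
    T? r (pt P) (pt Q) (pt S) = ¬? (P ≟ᵖ Q) ×-dec ¬? (P ≟ᵖ S) ×-dec ¬? (Q ≟ᵖ S) ×-dec
                                ¬? ((line P ≟ˡ line Q) ×-dec (line P ≟ˡ line S)) ×-dec (F P Q S ≟ʳ r)
    T? r (∞ b)  (pt P) (pt Q) = inf? r b P Q
    T? r (pt P) (∞ b)  (pt Q) = inf? r b P Q
    T? r (pt P) (pt Q) (∞ b)  = inf? r b P Q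
    T? r (∞ _)  (∞ _)  _      = no id
    T? r (∞ _)  (pt _) (∞ _)  = no id
    T? r (pt _) (∞ _)  (∞ _)  = no id

    inf-swap : ∀ {r b P Q} → Infinite r b P Q → Infinite r b Q P
    inf-swap (l≢ , e) = ≢-sym l≢ , [ inj₂ , inj₁ ]′ e

    swap₁₂ : ∀ {r} x y z → T r x y z → T r y x z
    swap₁₂ (pt P) (pt Q) (pt S) (P≢Q , P≢S , Q≢S , ¬l , eq) =
      ≢-sym P≢Q , Q≢S , P≢S , (λ { (a , b) → ¬l (sym a , trans (sym a) b) }) , trans (F-swap₁₂ Q P S) eq
    swap₁₂ (∞ _)  (pt _) (pt _) t = t
    swap₁₂ (pt _) (∞ _)  (pt _) t = t
    swap₁₂ (pt _) (pt _) (∞ _)  t = inf-swap t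

    swap₂₃ : ∀ {r} x y z → T r x y z → T r x z y
    swap₂₃ (pt P) (pt Q) (pt S) (P≢Q , P≢S , Q≢S , ¬l , eq) =
      P≢S , P≢Q , ≢-sym Q≢S , (λ { (a , b) → ¬l (b , a) }) , trans (F-swap₂₃ P S Q) eq
    swap₂₃ (∞ _)  (pt _) (pt _) t = inf-swap t
    swap₂₃ (pt _) (∞ _)  (pt _) t = t
    swap₂₃ (pt _) (pt _) (∞ _)  t = t

    distinct : ∀ {r} x y z → T r x y z → x ≢ y
    distinct (pt P) (pt .P) (pt S) (P≢Q , _) refl = P≢Q refl
    distinct (pt P) (pt .P) (∞ _)  (l≢ , _)  refl = l≢ refl
    distinct (∞ _)  (∞ _)   _      ()

    transversal : ∀ {r} x y z → T r x y z → ¬ ∃ λ l → On line l x × On line l y × On line l z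
    transversal (pt P) (pt Q) (pt S) (_ , _ , _ , ¬l , _) (l , a , b , d) = ¬l (trans a (sym b) , trans a (sym d))
    transversal (∞ _)  (pt P) (pt Q) (l≢ , _) (l , _ , b , d) = l≢ (trans b (sym d))
    transversal (pt P) (∞ _)  (pt Q) (l≢ , _) (l , a , _ , d) = l≢ (trans a (sym d))
    transversal (pt P) (pt Q) (∞ _)  (l≢ , _) (l , a , b , _) = l≢ (trans a (sym b))

    c-clash : ∀ {P Q b} → line P ≢ line Q → c P Q ≡ b → c Q P ≢ b
    c-clash l≢ refl eq = not-¬ eq (c-anti l≢)

    inf-functional : ∀ {r s b P Q} → Infinite r b P Q → Infinite s b P Q → r ≡ s
    inf-functional (_ , inj₁ (refl , _)) (_ , inj₁ (refl , _)) = refl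
    inf-functional (_ , inj₂ (refl , _)) (_ , inj₂ (refl , _)) = refl
    inf-functional (l≢ , inj₁ (_ , e)) (_ , inj₂ (_ , e′)) = ⊥-elim (c-clash l≢ e e′)
    inf-functional (l≢ , inj₂ (_ , e)) (_ , inj₁ (_ , e′)) = ⊥-elim (c-clash l≢ e′ e)

    functional : ∀ {r s} x y z → T r x y z → T s x y z → r ≡ s
    functional (pt _) (pt _) (pt _) (_ , _ , _ , _ , refl) (_ , _ , _ , _ , refl) = refl
    functional (∞ _)  (pt _) (pt _) t t′ = inf-functional t t′
    functional (pt _) (∞ _)  (pt _) t t′ = inf-functional t t′
    functional (pt _) (pt _) (∞ _)  t t′ = inf-functional t t′

    inf-total : ∀ b P Q → line P ≡ line Q ⊎ ∃ λ r → Infinite r b P Q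
    inf-total b P Q with line P ≟ˡ line Q | c P Q ≟ᵇ b
    ... | yes l≡ | _      = inj₁ l≡
    ... | no l≢  | yes eq = inj₂ (_ , l≢ , inj₁ (refl , eq))
    ... | no l≢  | no ne  = inj₂ (_ , l≢ , inj₂ (refl , trans (c-anti l≢) (sym (¬-not (≢-sym ne)))))

    total : ∀ x y z → x ≢ y → x ≢ z → y ≢ z →
            (∃ λ l → On line l x × On line l y × On line l z) ⊎ ∃ λ r → T r x y z
    total (pt P) (pt Q) (pt S) P≢Q P≢S Q≢S with (line P ≟ˡ line Q) ×-dec (line P ≟ˡ line S)
    ... | yes (a , b) = inj₁ (_ , refl , sym a , sym b)
    ... | no ¬l       = inj₂ (_ , P≢Q ∘ cong pt , P≢S ∘ cong pt , Q≢S ∘ cong pt , ¬l , refl)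
    total (∞ b)  (pt P) (pt Q) _ _ _ = map⊎ (λ eq → _ , tt , refl , sym eq) id (inf-total b P Q)
    total (pt P) (∞ b)  (pt Q) _ _ _ = map⊎ (λ eq → _ , refl , tt , sym eq) id (inf-total b P Q)
    total (pt P) (pt Q) (∞ b)  _ _ _ = map⊎ (λ eq → _ , refl , sym eq , tt) id (inf-total b P Q)
    total (∞ _)  (∞ _)  (pt S) _ _ _ = inj₁ (line S , tt , tt , refl)
    total (∞ _)  (pt S) (∞ _)  _ _ _ = inj₁ (line S , tt , refl , tt)
    total (pt S) (∞ _)  (∞ _)  _ _ _ = inj₁ (line S , refl , tt , tt)
    total (∞ a)  (∞ b)  (∞ d)  a≢b a≢d b≢d =
      ⊥-elim (bool-pigeonhole (a≢b ∘ cong ∞) (a≢d ∘ cong ∞) (b≢d ∘ cong ∞))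

    inf-avoid : ∀ {r b P Q} → line P ≡ hole r → ¬ Infinite r b P Q
    inf-avoid eq (l≢ , inj₁ (refl , _)) = l≢ (sym (closed⁻ refl (sym eq)))
    inf-avoid eq (l≢ , inj₂ (refl , _)) = l≢ (sym (apart (sym eq)))

    avoid : ∀ {r} x y z → On line (hole r) x → On line (hole r) y → ¬ T r x y z
    avoid (pt P) (pt Q) (pt S) onP onQ (_ , _ , _ , ¬l , refl) =
      ¬l (PQ , sym (closed⁻ PQ (sym onP))) where PQ = trans onP (sym onQ)
    avoid (∞ _)  (pt P) (pt Q) _ onP t = inf-avoid onP t
    avoid (pt P) (∞ _)  (pt Q) onP _ t = inf-avoid onP t
    avoid (pt P) (pt Q) (∞ _)  onP _ t = inf-avoid onP t

    -- In the system `r` one arc of colour `b` leaves P and one enters it; these give the two blocks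
    -- through `∞ b` and P. Their other ends differ, because opposite arcs have different colours,
    -- and `closed` keeps them off the line of P.
    two-inf : ∀ {r b P} → line P ≢ hole r → Two (T r (∞ b) (pt P))
    two-inf {r} {b} {P} P∉ with out P∉ b | into P∉ b
    ... | Q , (FPPQ , cPQ) , Q! | S , (FSSP , cSP) , S! =
      pt Q , pt S , (λ { refl → c-clash l≢ cPQ cSP }) , (l≢ , inj₁ (FPPQ , cPQ)) , (l≢′ , inj₂ (FSSP , cSP)) ,
      λ { (pt _) (_ , inj₁ t) → inj₁ (cong pt (sym (Q! t))) ; (pt _) (_ , inj₂ t) → inj₂ (cong pt (sym (S! t))) }
      where
      l≢ : line P ≢ line Q
      l≢ eq = P∉ (trans (sym (closed refl eq)) (cong hole FPPQ))
      l≢′ : line P ≢ line S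
      l≢′ eq = P∉ (trans eq (trans (sym (closed refl (sym eq))) (cong hole FSSP)))

    -- A solution S of F P Q S ≡ r that coincides with P or Q stands for a block through a point at infinity.
    at : V → V → V → Pt V
    at P Q S with S ≟ᵖ P | S ≟ᵖ Q
    ... | yes _ | _     = ∞ (c P Q)
    ... | no _  | yes _ = ∞ (c Q P)
    ... | no _  | no _  = pt S

    module _ {r P Q} (P≢Q : P ≢ Q) (¬on : ¬ (line P ≡ hole r × line Q ≡ hole r)) where

      FPQP : ∀ {r} → F P Q P ≡ r → F P P Q ≡ r
      FPQP = trans (F-swap₂₃ P P Q)

      FPQQ : ∀ {r} → F P Q Q ≡ r → F Q Q P ≡ r
      FPQQ = trans (trans (F-swap₂₃ Q Q P) (F-swap₁₂ Q P Q))

      -- If P, Q and S were on one line, `closed` would make that line the hole of `r`, which does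
      -- not contain both P and Q.
      transversal-PQ : ∀ {S} → F P Q S ≡ r → ¬ (line P ≡ line Q × line P ≡ line S)
      transversal-PQ refl (a , b) = ¬on (sym (closed a b) , sym (trans (closed a b) a))

      at-sound : ∀ {S} → F P Q S ≡ r → T r (pt P) (pt Q) (at P Q S)
      at-sound {S} eq with S ≟ᵖ P | S ≟ᵖ Q
      ... | yes refl | _        = (λ l≡ → transversal-PQ eq (l≡ , refl)) , inj₁ (FPQP eq , refl)
      ... | no _     | yes refl = (λ l≡ → transversal-PQ eq (l≡ , l≡)) , inj₂ (FPQQ eq , refl)
      ... | no S≢P   | no S≢Q   = P≢Q , ≢-sym S≢P , ≢-sym S≢Q , transversal-PQ eq , eq

      at-injective : ∀ {S S′} → F P Q S ≡ r → F P Q S′ ≡ r → at P Q S ≡ at P Q S′ → S ≡ S′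
      at-injective {S} {S′} eq eq′ e with S ≟ᵖ P | S ≟ᵖ Q | S′ ≟ᵖ P | S′ ≟ᵖ Q
      ... | yes refl | _        | yes refl | _        = refl
      ... | no _     | yes refl | no _     | yes refl = refl
      ... | no _     | no _     | no _     | no _     = inj₂-injective e
      -- Here one solution is P and the other Q; the same point at infinity would give two opposite
      -- arcs the same colour.
      ... | yes refl | _        | no _     | yes refl =
        ⊥-elim (c-clash (λ l≡ → transversal-PQ eq (l≡ , refl)) (inj₁-injective e) refl)
      ... | no _     | yes refl | yes refl | _        =
        ⊥-elim (c-clash (λ l≡ → transversal-PQ eq (l≡ , l≡)) (sym (inj₁-injective e)) refl)

      at-P : at P Q P ≡ ∞ (c P Q)
      at-P with P ≟ᵖ P
      ... | yes _ = refl
      ... | no ne = ⊥-elim (ne refl)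

      at-Q : at P Q Q ≡ ∞ (c Q P)
      at-Q with Q ≟ᵖ P | Q ≟ᵖ Q
      ... | yes Q≡P | _     = ⊥-elim (P≢Q (sym Q≡P))
      ... | no _    | yes _ = refl
      ... | no _    | no ne = ⊥-elim (ne refl)

      at-other : ∀ {S} → P ≢ S → Q ≢ S → at P Q S ≡ pt S
      at-other {S} P≢S Q≢S with S ≟ᵖ P | S ≟ᵖ Q
      ... | yes S≡P | _       = ⊥-elim (P≢S (sym S≡P))
      ... | no _    | yes S≡Q = ⊥-elim (Q≢S (sym S≡Q))
      ... | no _    | no _    = refl

      at-complete : ∀ z → T r (pt P) (pt Q) z → ∃ λ S → F P Q S ≡ r × z ≡ at P Q S
      at-complete (pt S) (_ , P≢S , Q≢S , _ , eq) = S , eq , sym (at-other P≢S Q≢S)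
      at-complete (∞ b) (_ , inj₁ (eq , refl)) = P , trans (F-swap₂₃ P Q P) eq , sym at-P
      at-complete (∞ b) (_ , inj₂ (eq , refl)) = Q , trans (F-swap₁₂ P Q Q) (trans (F-swap₂₃ Q P Q) eq) , sym at-Q

      two-pt : Two (T r (pt P) (pt Q))
      two-pt = Two-map (at P Q) at-injective at-sound (at-complete _) (F-two P Q r)

    two : ∀ {r} x y → x ≢ y → ¬ (On line (hole r) x × On line (hole r) y) → Two (T r x y)
    two (∞ _)  (∞ _)  _   ¬on = ⊥-elim (¬on (tt , tt))
    two (∞ b)  (pt P) _   ¬on = two-inf (¬on ∘ (tt ,_))
    two (pt P) (∞ b)  _   ¬on = Two-map id (λ _ _ → id) (λ {z} → swap₁₂ (∞ b) (pt P) z)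
      (λ {z} t → z , swap₁₂ (pt P) (∞ b) z t , refl) (two-inf (¬on ∘ (_, tt)))
    two (pt P) (pt Q) x≢y ¬on = two-pt (x≢y ∘ cong pt) ¬on

  holeSystem : HoleSystem (On line) hole
  holeSystem = record
    { T           = T
    ; T?          = T?
    ; swap₁₂      = λ {_} {x} {y} {z} → swap₁₂ x y z
    ; swap₂₃      = λ {_} {x} {y} {z} → swap₂₃ x y z
    ; distinct    = λ {_} {x} {y} {z} → distinct x y z
    ; transversal = λ {_} {x} {y} {z} → transversal x y z
    ; functional  = λ {_} {_} {x} {y} {z} → functional x y z
    ; total       = λ {x} {y} {z} → total x y z
    ; avoid       = λ {_} {x} {y} {z} → avoid x y z
    ; two         = λ {_} {x} {y} → two x y
    }

-- Congruences and residues modulo k.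

module Modulo (k : ℕ) .{{_ : NonZero k}} where
  open ℤ using (ℤ; +_; -[1+_]; _+_; _*_; _-_; -_; _%ℕ_; _/ℕ_)
  open ℤ-Solver using (solve-∀)

  infix 4 _≈_
  record _≈_ (x y : ℤ) : Set where
    constructor by
    field
      quotient : ℤ
      equation : x ≡ y + quotient * + k

  ι : Fin k → ℤ
  ι i = + toℕ i

  -- Reduces a modular calculation to a polynomial identity between differences, which the ring
  -- solver proves.
  ≈-combine : ∀ {x₁ y₁ x₂ y₂} {x y : ℤ} a₁ a₂ → x₁ ≈ y₁ → x₂ ≈ y₂ →
            x - y ≡ a₁ * (x₁ - y₁) + a₂ * (x₂ - y₂) → x ≈ y
  ≈-combine {x₁} {y₁} {x₂} {y₂} {x} {y} a₁ a₂ (by q₁ e₁) (by q₂ e₂) eq = by (a₁ * q₁ + a₂ * q₂) (begin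
    x                                                               ≡⟨ split x y ⟩
    y + (x - y)                                                     ≡⟨ cong (_+_ y) eq ⟩
    y + (a₁ * (x₁ - y₁) + a₂ * (x₂ - y₂))
      ≡⟨ cong₂ (λ u w → y + (a₁ * (u - y₁) + a₂ * (w - y₂))) e₁ e₂ ⟩
    y + (a₁ * (y₁ + q₁ * + k - y₁) + a₂ * (y₂ + q₂ * + k - y₂))     ≡⟨ collect y a₁ a₂ y₁ y₂ q₁ q₂ (+ k) ⟩
    y + (a₁ * q₁ + a₂ * q₂) * + k                                   ∎)
    where
    open ≡-Reasoning
    split : ∀ x y → x ≡ y + (x - y)
    split = solve-∀
    collect : ∀ y a₁ a₂ y₁ y₂ q₁ q₂ k →
              y + (a₁ * (y₁ + q₁ * k - y₁) + a₂ * (y₂ + q₂ * k - y₂)) ≡ y + (a₁ * q₁ + a₂ * q₂) * k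
    collect = solve-∀

  ≈-refl : ∀ {x} → x ≈ x
  ≈-refl {x} = by (+ 0) (sym (ℤₚ.+-identityʳ x))

  -- The case of a single congruence; the second place is filled with 0 ≈ 0.
  ≈-shift : ∀ {x₁ y₁ x y} → x₁ ≈ y₁ → x - y ≡ x₁ - y₁ → x ≈ y
  ≈-shift {x₁} {y₁} e eq = ≈-combine (+ 1) (+ 0) e (≈-refl {+ 0}) (trans eq (lemma x₁ y₁))
    where
    lemma : ∀ x₁ y₁ → x₁ - y₁ ≡ + 1 * (x₁ - y₁) + + 0 * (+ 0 - + 0)
    lemma = solve-∀

  ≈-sym : ∀ {x y} → x ≈ y → y ≈ x
  ≈-sym {x} {y} e = ≈-combine (- (+ 1)) (+ 0) e (≈-refl {+ 0}) (lemma x y)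
    where
    lemma : ∀ x y → y - x ≡ - (+ 1) * (x - y) + + 0 * (+ 0 - + 0)
    lemma = solve-∀

  ≈-trans : ∀ {x y z} → x ≈ y → y ≈ z → x ≈ z
  ≈-trans {x} {y} {z} e e′ = ≈-combine (+ 1) (+ 1) e e′ (lemma x y z)
    where
    lemma : ∀ x y z → x - z ≡ + 1 * (x - y) + + 1 * (y - z)
    lemma = solve-∀

  abstract
    residue : ℤ → Fin k
    residue z = fromℕ< (n%ℕd<d z k)

    residue-≈ : ∀ z → ι (residue z) ≈ z
    residue-≈ z = by (- (z /ℕ k)) (begin
      + toℕ (residue z)                                        ≡⟨ cong +_ (toℕ-fromℕ< (n%ℕd<d z k)) ⟩
      + (z %ℕ k)                                               ≡⟨ lemma (+ (z %ℕ k)) (z /ℕ k) (+ k) ⟩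
      + (z %ℕ k) + (z /ℕ k) * + k + - (z /ℕ k) * + k           ≡⟨ cong (_+ - (z /ℕ k) * + k) (sym (a≡a%ℕn+[a/ℕn]*n z k)) ⟩
      z + - (z /ℕ k) * + k                                     ∎)
      where
      open ≡-Reasoning
      lemma : ∀ r q k → r ≡ r + q * k + - q * k
      lemma = solve-∀

  private
    below : ∀ {i j} n → i < k → i ≢ j ℕ.+ suc n ℕ.* k
    below {i} {j} n i<k refl = ℕₚ.<⇒≱ i<k (ℕₚ.≤-trans (ℕₚ.m≤m+n k (n ℕ.* k)) (ℕₚ.m≤n+m _ j))

    -- A positive quotient would make `i` at least `k`, and a negative one would make `j` at least
    -- `k`.
    ≈⇒≡-< : ∀ {i j} → i < k → j < k → + i ≈ + j → i ≡ j
    ≈⇒≡-< {i} {j} i<k j<k (by (+ zero) eq) = ℤₚ.+-injective (trans eq (ℤₚ.+-identityʳ (+ j)))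
    ≈⇒≡-< {i} {j} i<k j<k (by (+ suc n) eq) = ⊥-elim (below {j = j} n i<k (ℤₚ.+-injective (begin
      + i                        ≡⟨ eq ⟩
      + j + + suc n * + k        ≡⟨ cong (_+_ (+ j)) (sym (ℤₚ.pos-* (suc n) k)) ⟩
      + j + + (suc n ℕ.* k)      ≡⟨ sym (ℤₚ.pos-+ j _) ⟩
      + (j ℕ.+ suc n ℕ.* k)      ∎)))
      where open ≡-Reasoning
    ≈⇒≡-< {i} {j} i<k j<k (by -[1+ n ] eq) = ⊥-elim (below {j = i} n j<k (ℤₚ.+-injective (begin
      + j                                          ≡⟨ lemma (+ j) (+ suc n) (+ k) ⟩
      + j + -[1+ n ] * + k + + suc n * + k         ≡⟨ cong (_+ + suc n * + k) (sym eq) ⟩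
      + i + + suc n * + k                          ≡⟨ cong (_+_ (+ i)) (sym (ℤₚ.pos-* (suc n) k)) ⟩
      + i + + (suc n ℕ.* k)                        ≡⟨ sym (ℤₚ.pos-+ i _) ⟩
      + (i ℕ.+ suc n ℕ.* k)                        ∎)))
      where
      open ≡-Reasoning
      lemma : ∀ j n k → j ≡ j + - n * k + n * k
      lemma = solve-∀

  ι-injective : ∀ {i j} → ι i ≈ ι j → i ≡ j
  ι-injective {i} {j} = toℕ-injective ∘ ≈⇒≡-< (toℕ<n i) (toℕ<n j)

  residue⁺ : ∀ z {i} → z ≈ ι i → residue z ≡ i
  residue⁺ z e = ι-injective (≈-trans (residue-≈ z) e)

  residue⁻ : ∀ z {i} → residue z ≡ i → z ≈ ι i
  residue⁻ z refl = ≈-sym (residue-≈ z)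

  -- Together with `residue-+-unique` this solves t + d ≡ i for d, which fixes the last coordinate
  -- of a point once the other data are known.
  residue-+ : ∀ t i → residue (t + ι (residue (ι i - t))) ≡ i
  residue-+ t i = residue⁺ (t + ι (residue (ι i - t)))
    (≈-shift (residue-≈ (ι i - t)) (lemma t (ι (residue (ι i - t))) (ι i)))
    where
    lemma : ∀ t d i → t + d - i ≡ d - (i - t)
    lemma = solve-∀

  residue-+-unique : ∀ t {i d} → residue (t + ι d) ≡ i → d ≡ residue (ι i - t)
  residue-+-unique t {i} {d} e = sym (residue⁺ (ι i - t) (≈-shift (≈-sym (residue⁻ (t + ι d) e)) (lemma t (ι d) (ι i))))
    where
    lemma : ∀ t d i → i - t - d ≡ i - (t + d)
    lemma = solve-∀

  -- Subtracting `k` once if necessary brings `n` into the range of residues. The lemma is meant for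
  -- n = 2a + e, with a in ℤₖ and e a bit.
  residues-below-2k : ∀ {n} (t : Fin k) → n < 2 ℕ.* k → + n ≈ ι t → n ≡ toℕ t ⊎ n ≡ k ℕ.+ toℕ t
  residues-below-2k {n} t n<2k e with n ℕ.<? k
  ... | yes n<k = inj₁ (≈⇒≡-< n<k (toℕ<n t) e)
  ... | no n≮k  with j , refl ← ℕₚ.m≤n⇒∃[o]m+o≡n (ℕₚ.≮⇒≥ n≮k) = inj₂ (cong (k ℕ.+_)
    (≈⇒≡-< (ℕₚ.+-cancelˡ-< k j k (subst (k ℕ.+ j <_) (cong (k ℕ.+_) (ℕₚ.+-identityʳ k)) n<2k)) (toℕ<n t)
           (≈-trans (≈-sym j≈) e)))
    where
    j≈ : + (k ℕ.+ j) ≈ + j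
    j≈ = by (+ 1) (trans (cong +_ (ℕₚ.+-comm k j)) (trans (ℤₚ.pos-+ j k) (cong (_+_ (+ j)) (sym (ℤₚ.*-identityˡ (+ k))))))

-- Parity, majority and an alternating colouring of the numbers below 2k.

odd : ℕ → Bool
odd zero    = false
odd (suc n) = not (odd n)

bit : Bool → ℕ
bit false = 0
bit true  = 1

bit-odd : ∀ n → bit (odd n) ℕ.+ 2 ℕ.* ⌊ n /2⌋ ≡ n
bit-odd zero          = refl
bit-odd (suc zero)    = refl
bit-odd (suc (suc n)) = begin
  bit (not (not (odd n))) ℕ.+ 2 ℕ.* suc ⌊ n /2⌋
    ≡⟨ cong₂ (λ b m → bit b ℕ.+ m) (not-involutive (odd n)) (ℕₚ.*-suc 2 ⌊ n /2⌋) ⟩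
  bit (odd n) ℕ.+ (2 ℕ.+ 2 ℕ.* ⌊ n /2⌋)          ≡⟨ ℕₚ.+-comm (bit (odd n)) _ ⟩
  2 ℕ.+ 2 ℕ.* ⌊ n /2⌋ ℕ.+ bit (odd n)            ≡⟨ cong (2 ℕ.+_) (ℕₚ.+-comm (2 ℕ.* ⌊ n /2⌋) _) ⟩
  2 ℕ.+ (bit (odd n) ℕ.+ 2 ℕ.* ⌊ n /2⌋)          ≡⟨ cong (2 ℕ.+_) (bit-odd n) ⟩
  2 ℕ.+ n                                        ∎
  where open ≡-Reasoning

odd-bit : ∀ e a → odd (bit e ℕ.+ 2 ℕ.* a) ≡ e
odd-bit false zero    = refl
odd-bit true  zero    = refl
odd-bit e     (suc a) = begin
  odd (bit e ℕ.+ 2 ℕ.* suc a)          ≡⟨ cong (λ m → odd (bit e ℕ.+ m)) (ℕₚ.*-suc 2 a) ⟩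
  odd (bit e ℕ.+ (2 ℕ.+ 2 ℕ.* a))      ≡⟨ cong odd (trans (ℕₚ.+-suc (bit e) _) (cong suc (ℕₚ.+-suc (bit e) _))) ⟩
  not (not (odd (bit e ℕ.+ 2 ℕ.* a)))  ≡⟨ not-involutive _ ⟩
  odd (bit e ℕ.+ 2 ℕ.* a)              ≡⟨ odd-bit e a ⟩
  e                                    ∎
  where open ≡-Reasoning

-- Since majority e e e′ = e, the arcs from (x , 0) and (x , 1) into a point have opposite parities in ℤₖ, so that there
-- are two arcs into every point even if k is even and doubling in ℤₖ is not injective.
majority : Bool → Bool → Bool → Bool
majority false e₂ e₃ = e₂ ∧ e₃
majority true  e₂ e₃ = e₂ ∨ e₃

majority-swap₁₂ : ∀ a b c → majority a b c ≡ majority b a c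
majority-swap₁₂ false false c = refl
majority-swap₁₂ false true  c = refl
majority-swap₁₂ true  false c = refl
majority-swap₁₂ true  true  c = refl

majority-swap₂₃ : ∀ a b c → majority a b c ≡ majority a c b
majority-swap₂₃ false false false = refl
majority-swap₂₃ false false true  = refl
majority-swap₂₃ false true  false = refl
majority-swap₂₃ false true  true  = refl
majority-swap₂₃ true  false false = refl
majority-swap₂₃ true  false true  = refl
majority-swap₂₃ true  true  false = refl
majority-swap₂₃ true  true  true  = refl

majority-twice : ∀ a b → majority a a b ≡ a
majority-twice false b = refl
majority-twice true  b = refl

∃!-Bool : ∀ {g : Bool → Bool} → g true ≡ not (g false) → ∀ w → ∃! _≡_ λ e → g e ≡ w
∃!-Bool {g} flip w with g false ≟ᵇ w
... | yes p = false , p , λ { {false} _ → refl ; {true} q → ⊥-elim (not-¬ (trans q (sym p)) flip) }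
... | no ¬p = true , trans flip (sym (¬-not (≢-sym ¬p))) , λ { {false} q → ⊥-elim (¬p q) ; {true} _ → refl }

-- The numbers 2a and 2a + 1 get different colours, and so do t and k + t, whatever the parity of k.
module Alternating (k : ℕ) .{{_ : NonZero k}} where
  open ℤ using (ℤ; +_; _+_)
  open Modulo k

  alternate : ℕ → Bool
  alternate n = if n <ᵇ k then odd n else not (odd (n ∸ k))

  alternate-< : ∀ {n} → n < k → alternate n ≡ odd n
  alternate-< {n} n<k with n <ᵇ k | ℕₚ.<⇒<ᵇ n<k
  ... | true | _ = refl

  alternate-≥ : ∀ n → alternate (k ℕ.+ n) ≡ not (odd n)
  alternate-≥ n with (k ℕ.+ n) <ᵇ k in eq
  ... | false = cong (not ∘ odd) (ℕₚ.m+n∸m≡n k n)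
  ... | true  = ⊥-elim (ℕₚ.<⇒≱ (ℕₚ.<ᵇ⇒< (k ℕ.+ n) k (subst IsTrue (sym eq) _)) (ℕₚ.m≤m+n k n))

  -- On either side of `k` the colour follows parity and so changes at each step. At the seam
  -- `suc n` = `k` the new colour is the inverted parity of 0, and this differs from the colour of
  -- `n` exactly because `n` is even.
  alternate-suc : ∀ n → odd n ≡ false → alternate (suc n) ≡ not (alternate n)
  alternate-suc n even with ℕₚ.<-cmp (suc n) k
  ... | tri< sn<k _ _ = trans (alternate-< sn<k) (cong not (sym (alternate-< (ℕₚ.<-trans (ℕₚ.n<1+n n) sn<k))))
  ... | tri≈ _ refl _ = trans (trans (cong alternate (sym (ℕₚ.+-identityʳ (suc n)))) (alternate-≥ 0))
                              (cong not (sym (trans (alternate-< (ℕₚ.n<1+n n)) even)))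
  ... | tri> _ _ k≤n with m , refl ← ℕₚ.m≤n⇒∃[o]m+o≡n (ℕ.s≤s⁻¹ k≤n) =
    trans (trans (cong alternate (sym (ℕₚ.+-suc k m))) (alternate-≥ (suc m))) (cong not (sym (alternate-≥ m)))

  -- The pair `(e , a)` is read as the number 2a + e below 2k, with `e` as its last binary digit.
  ε : Bool → Fin k → Bool
  ε e a = alternate (bit e ℕ.+ 2 ℕ.* toℕ a)

  ε-out : ∀ a w → ∃! _≡_ λ e → ε e a ≡ w
  ε-out a = ∃!-Bool (alternate-suc (2 ℕ.* toℕ a) (odd-bit false (toℕ a)))

  twice : Bool → Fin k → ℤ
  twice e a = ι a + ι a + + bit e

  twice-+ : ∀ e a → twice e a ≡ + (bit e ℕ.+ 2 ℕ.* toℕ a)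
  twice-+ e a = begin
    ι a + ι a + + bit e            ≡⟨ cong (_+ + bit e) (sym (ℤₚ.pos-+ (toℕ a) (toℕ a))) ⟩
    + (toℕ a ℕ.+ toℕ a) + + bit e  ≡⟨ sym (ℤₚ.pos-+ (toℕ a ℕ.+ toℕ a) (bit e)) ⟩
    + (toℕ a ℕ.+ toℕ a ℕ.+ bit e)  ≡⟨ cong +_ (ℕₚ.+-comm (toℕ a ℕ.+ toℕ a) (bit e)) ⟩
    + (bit e ℕ.+ (toℕ a ℕ.+ toℕ a)) ≡⟨ cong (λ m → + (bit e ℕ.+ (toℕ a ℕ.+ m))) (sym (ℕₚ.+-identityʳ (toℕ a))) ⟩
    + (bit e ℕ.+ 2 ℕ.* toℕ a)      ∎
    where open ≡-Reasoning

  bit≤1 : ∀ e → bit e ≤ 1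
  bit≤1 false = ℕ.z≤n
  bit≤1 true  = ℕₚ.≤-refl

  digits< : ∀ e (a : Fin k) → bit e ℕ.+ 2 ℕ.* toℕ a < 2 ℕ.* k
  digits< e a = begin-strict
    bit e ℕ.+ 2 ℕ.* toℕ a  ≤⟨ ℕₚ.+-monoˡ-≤ _ (bit≤1 e) ⟩
    1 ℕ.+ 2 ℕ.* toℕ a      <⟨ ℕₚ.n<1+n _ ⟩
    2 ℕ.+ 2 ℕ.* toℕ a      ≡⟨ sym (ℕₚ.*-suc 2 (toℕ a)) ⟩
    2 ℕ.* suc (toℕ a)      ≤⟨ ℕₚ.*-monoʳ-≤ 2 (toℕ<n a) ⟩
    2 ℕ.* k                ∎
    where open ℕₚ.≤-Reasoning

  digits-injective : ∀ {e e′} {a a′ : Fin k} → bit e ℕ.+ 2 ℕ.* toℕ a ≡ bit e′ ℕ.+ 2 ℕ.* toℕ a′ → (e , a) ≡ (e′ , a′)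
  digits-injective {e} {e′} {a} {a′} eq with trans (sym (odd-bit e (toℕ a))) (trans (cong odd eq) (odd-bit e′ (toℕ a′)))
  ... | refl = cong (e ,_) (toℕ-injective (ℕₚ.*-cancelˡ-≡ _ _ 2 (ℕₚ.+-cancelˡ-≡ (bit e) _ _ eq)))

  digits : ∀ {n} → n < 2 ℕ.* k → ∃₂ λ e (a : Fin k) → bit e ℕ.+ 2 ℕ.* toℕ a ≡ n
  digits {n} n<2k = odd n , fromℕ< half<k , trans (cong (λ m → bit (odd n) ℕ.+ 2 ℕ.* m) (toℕ-fromℕ< half<k)) (bit-odd n)
    where
    half<k : ⌊ n /2⌋ < k
    half<k = ℕₚ.*-cancelˡ-< 2 _ _ (ℕₚ.≤-<-trans (subst (2 ℕ.* ⌊ n /2⌋ ≤_) (bit-odd n) (ℕₚ.m≤n+m _ (bit (odd n)))) n<2k)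

  t<2k : ∀ (t : Fin k) → toℕ t < 2 ℕ.* k
  t<2k t = ℕₚ.<-≤-trans (toℕ<n t) (ℕₚ.m≤m+n k _)

  k+t<2k : ∀ (t : Fin k) → k ℕ.+ toℕ t < 2 ℕ.* k
  k+t<2k t = ℕₚ.+-monoʳ-< k (subst (toℕ t <_) (sym (ℕₚ.+-identityʳ k)) (toℕ<n t))

  -- As a number below 2k, 2a + e is either t or k + t, and `alternate` colours these two
  -- differently; exactly one of them has colour `w`.
  ε-into : ∀ t w → ∃! _≡_ λ (ea : Bool × Fin k) → twice (proj₁ ea) (proj₂ ea) ≈ ι t × ε (proj₁ ea) (proj₂ ea) ≡ w
  ε-into t w = case odd (toℕ t) ≟ᵇ w of λ
    { (yes p) → pick (t<2k t) ≈-refl (trans (alternate-< (toℕ<n t)) p)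
                  λ { (inj₁ eq) _ → eq
                    ; (inj₂ refl) q → ⊥-elim (not-¬ (sym (trans p (sym q))) (alternate-≥ (toℕ t))) }
    ; (no ¬p) → pick (k+t<2k t) k+t≈t (trans (alternate-≥ (toℕ t)) (sym (¬-not (≢-sym ¬p))))
                  λ { (inj₁ refl) q → ⊥-elim (¬p (trans (sym (alternate-< (toℕ<n t))) q))
                    ; (inj₂ eq) _ → eq }
    }
    where
    k+t≈t : + (k ℕ.+ toℕ t) ≈ ι t
    k+t≈t = by (+ 1) (trans (cong +_ (ℕₚ.+-comm k (toℕ t)))
                     (trans (ℤₚ.pos-+ (toℕ t) k) (cong (_+_ (ι t)) (sym (ℤₚ.*-identityˡ (+ k))))))
    pick : ∀ {n} → n < 2 ℕ.* k → + n ≈ ι t → alternate n ≡ w →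
           (∀ {m} → m ≡ toℕ t ⊎ m ≡ k ℕ.+ toℕ t → alternate m ≡ w → m ≡ n) →
           ∃! _≡_ λ (ea : Bool × Fin k) → twice (proj₁ ea) (proj₂ ea) ≈ ι t × ε (proj₁ ea) (proj₂ ea) ≡ w
    pick n<2k n≈t aw unique with e , a , refl ← digits n<2k =
      (e , a) , (subst (_≈ ι t) (sym (twice-+ e a)) n≈t , aw) ,
      λ { {e′ , a′} (≈t , aw′) → digits-injective
            (sym (unique (residues-below-2k t (digits< e′ a′) (subst (_≈ ι t) (twice-+ e′ a′) ≈t)) aw′)) }

-- Inflation of a small cube to a coloured cube.

-- The arcs of f p p q = r do not depend on the ℤ₂-coordinate of q, nor, seen from q, on that of p.
record DoubleCube {N Λ : Set} (line : N → Λ) : Set where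
  field
    f        : N × Bool → N × Bool → N × Bool → N
    f-swap₁₂ : ∀ p q s → f p q s ≡ f q p s
    f-swap₂₃ : ∀ p q s → f p q s ≡ f p s q
    f-two    : ∀ p q r → Two (λ s → f p q s ≡ r)
    closed   : ∀ p q s → line (proj₁ p) ≡ line (proj₁ q) → line (proj₁ p) ≡ line (proj₁ s) →
               line (f p q s) ≡ line (proj₁ p)
    closed⁻  : ∀ p q s → line (proj₁ p) ≡ line (proj₁ q) → line (f p q s) ≡ line (proj₁ p) →
               line (proj₁ s) ≡ line (proj₁ p)
    apart    : ∀ p q → line (f p p q) ≡ line (proj₁ q) → line (proj₁ p) ≡ line (proj₁ q)
    out      : ∀ p r → line (proj₁ p) ≢ line r →
               ∃ λ z → (∀ e → f p p (z , e) ≡ r) × (∀ y e → f p p (y , e) ≡ r → z ≡ y)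
    into     : ∀ q r → line (proj₁ q) ≢ line r →
               ∃ λ x → (∀ e → f (x , e) (x , e) q ≡ r) × (∀ y e → f (y , e) (y , e) q ≡ r → x ≡ y)

private
  xor-solve₃ : ∀ x y z {b} → x xor (y xor z) ≡ b → z ≡ x xor (y xor b)
  xor-solve₃ false false z refl = refl
  xor-solve₃ false true  z refl = sym (not-involutive z)
  xor-solve₃ true  false z refl = sym (not-involutive z)
  xor-solve₃ true  true  z refl = sym (trans (not-involutive _) (not-involutive z))

  xor-solve₂ : ∀ x y z {b} → x xor (y xor z) ≡ b → y ≡ x xor (z xor b)
  xor-solve₂ x y z {b} eq = xor-solve₃ x z y (trans (cong (x xor_) (xor-comm z y)) eq)

  xor-anti : ∀ {s s′} x y → s′ ≡ not s → s′ xor (y xor x) ≡ not (s xor (x xor y))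
  xor-anti {false} false false refl = refl
  xor-anti {false} false true  refl = refl
  xor-anti {false} true  false refl = refl
  xor-anti {false} true  true  refl = refl
  xor-anti {true}  false false refl = refl
  xor-anti {true}  false true  refl = refl
  xor-anti {true}  true  false refl = refl
  xor-anti {true}  true  true  refl = refl

module _ {N Λ : Set} {line : N → Λ} (s : Λ → Λ → Bool) (s-anti : ∀ {l l′} → l ≢ l′ → s l′ l ≡ not (s l l′))
  (D : DoubleCube line) (k : ℕ) .{{_ : NonZero k}} where
  open DoubleCube D
  open ℤ using (ℤ; +_; _+_; _-_)
  open ℤ-Solver using (solve-∀)
  open Modulo k
  open Alternating k

  private
    V R : Set
    V = (N × Bool) × Fin k
    R = N × Fin k

    m : N × Bool → N × Bool → N × Bool → ℤ
    m (_ , e) (_ , e′) (_ , e″) = + bit (majority e e′ e″)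

    F : V → V → V → R
    F (p , a) (q , b) (t , d) = f p q t , residue (ι a + ι b + m p q t + ι d)

    -- The tournament `s` on the lines supplies the antisymmetry. The other term is symmetric, and
    -- it allows the colour to be adjusted through the `ε`-colour of either end.
    c : V → V → Bool
    c ((x , e) , a) ((y , e′) , b) = s (line x) (line y) xor (ε e a xor ε e′ b)

    -- Each of the two solutions for `f` fixes the coordinate in ℤₖ by subtraction.
    F-two : ∀ P Q r → Two (λ S → F P Q S ≡ r)
    F-two (p , a) (q , b) (ρ , κ) = Two-map (λ t → t , residue (ι κ - offset t))
      (λ _ _ → cong proj₁)
      (λ {t} eq → cong₂ _,_ eq (residue-+ (offset t) κ))
      (λ { {t , d} eq → t , cong proj₁ eq , cong (t ,_) (residue-+-unique (offset t) (cong proj₂ eq)) })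
      (f-two p q ρ)
      where
      offset : N × Bool → ℤ
      offset t = ι a + ι b + m p q t

    F-swap₁₂ : ∀ P Q S → F P Q S ≡ F Q P S
    F-swap₁₂ (p@(_ , e) , a) (q@(_ , e′) , b) (t@(_ , e″) , d) = cong₂ _,_ (f-swap₁₂ p q t)
      (cong residue (trans (cong (λ w → ι a + ι b + + bit w + ι d) (majority-swap₁₂ e e′ e″))
                           (lemma (ι a) (ι b) (m q p t) (ι d))))
      where
      lemma : ∀ a b m d → a + b + m + d ≡ b + a + m + d
      lemma = solve-∀

    F-swap₂₃ : ∀ P Q S → F P Q S ≡ F P S Q
    F-swap₂₃ (p@(_ , e) , a) (q@(_ , e′) , b) (t@(_ , e″) , d) = cong₂ _,_ (f-swap₂₃ p q t)
      (cong residue (trans (cong (λ w → ι a + ι b + + bit w + ι d) (majority-swap₂₃ e e′ e″))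
                           (lemma (ι a) (ι b) (m p t q) (ι d))))
      where
      lemma : ∀ a b m d → a + b + m + d ≡ a + d + m + b
      lemma = solve-∀

    -- The majority of e, e and e′ is e, so the second coordinate of an arc ignores the bit of its
    -- head.
    F-diagonal : ∀ x e a q b → proj₂ (F ((x , e) , a) ((x , e) , a) (q , b)) ≡ residue (twice e a + ι b)
    F-diagonal x e a (_ , e′) b = cong (λ w → residue (ι a + ι a + + bit w + ι b)) (majority-twice e e′)

    F-diagonal⁺ : ∀ x e a q b {ρ κ} → f (x , e) (x , e) q ≡ ρ → residue (twice e a + ι b) ≡ κ →
                  F ((x , e) , a) ((x , e) , a) (q , b) ≡ (ρ , κ)
    F-diagonal⁺ x e a q b refl refl = cong (f (x , e) (x , e) q ,_) (F-diagonal x e a q b)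

    F-diagonal⁻ : ∀ x e a q b {ρ κ} → F ((x , e) , a) ((x , e) , a) (q , b) ≡ (ρ , κ) →
                  f (x , e) (x , e) q ≡ ρ × residue (twice e a + ι b) ≡ κ
    F-diagonal⁻ x e a q b refl = refl , sym (F-diagonal x e a q b)

    -- `f` determines the coordinate of Q in `N`, and subtraction the one in ℤₖ. Only the bit of Q
    -- is left, and its two values give both colours.
    F-out : ∀ P r → line (proj₁ (proj₁ P)) ≢ line (proj₁ r) → ∀ b → ∃! _≡_ λ Q → F P P Q ≡ r × c P Q ≡ b
    F-out ((x , e) , a) (ρ , κ) P∉ b = ((z , e′) , d) , (sound , coloured) , unique
      where
      z = proj₁ (out (x , e) ρ P∉)
      z-out = proj₁ (proj₂ (out (x , e) ρ P∉))
      z-unique = proj₂ (proj₂ (out (x , e) ρ P∉))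
      d : Fin k
      d = residue (ι κ - twice e a)
      σ w : Bool
      σ = s (line x) (line z)
      -- The `ε`-colour that Q must have for `c P Q` to equal `b`.
      w = σ xor (ε e a xor b)
      e′ : Bool
      e′ = proj₁ (ε-out d w)
      sound : F ((x , e) , a) ((x , e) , a) ((z , e′) , d) ≡ (ρ , κ)
      sound = F-diagonal⁺ x e a (z , e′) d (z-out e′) (residue-+ (twice e a) κ)
      coloured : c ((x , e) , a) ((z , e′) , d) ≡ b
      coloured = sym (xor-solve₃ σ (ε e a) b (sym (proj₁ (proj₂ (ε-out d w)))))
      same : ∀ {y e″ d′} → z ≡ y → d′ ≡ d → c ((x , e) , a) ((y , e″) , d′) ≡ b → ((z , e′) , d) ≡ ((y , e″) , d′)
      same {e″ = e″} refl refl ceq =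
        cong (λ e → (z , e) , d) (proj₂ (proj₂ (ε-out d w)) (xor-solve₃ σ (ε e a) (ε e″ d) ceq))
      unique : ∀ {Q} → F ((x , e) , a) ((x , e) , a) Q ≡ (ρ , κ) × c ((x , e) , a) Q ≡ b → ((z , e′) , d) ≡ Q
      unique {(y , e″) , d′} (Feq , ceq) with feq , keq ← F-diagonal⁻ x e a (y , e″) d′ Feq =
        same (z-unique y e″ feq) (residue-+-unique (twice e a) keq) ceq

    -- `f` determines the coordinate of P in `N`. For its bit and its coordinate in ℤₖ there remains
    -- the congruence 2a + e ≡ t, which has two solutions, of different `ε`-colours.
    F-into : ∀ Q r → line (proj₁ (proj₁ Q)) ≢ line (proj₁ r) → ∀ b → ∃! _≡_ λ P → F P P Q ≡ r × c P Q ≡ b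
    F-into ((y , e) , d) (ρ , κ) Q∉ b = ((z , e′) , a) , (sound , coloured) , unique
      where
      z = proj₁ (into (y , e) ρ Q∉)
      z-into = proj₁ (proj₂ (into (y , e) ρ Q∉))
      z-unique = proj₂ (proj₂ (into (y , e) ρ Q∉))
      t : Fin k
      t = residue (ι κ - ι d)
      σ w : Bool
      σ = s (line z) (line y)
      w = σ xor (ε e d xor b)
      e′ : Bool
      e′ = proj₁ (proj₁ (ε-into t w))
      a : Fin k
      a = proj₂ (proj₁ (ε-into t w))
      ea-unique = proj₂ (proj₂ (ε-into t w))
      from-t : ∀ {u} → u ≈ ι t → u + ι d ≈ ι κ
      from-t {u} e = ≈-shift (≈-trans e (residue-≈ (ι κ - ι d))) (lemma u (ι d) (ι κ))
        where
        lemma : ∀ u d κ → u + d - κ ≡ u - (κ - d)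
        lemma = solve-∀
      to-t : ∀ {u} → u + ι d ≈ ι κ → u ≈ ι t
      to-t {u} e = ≈-trans (≈-shift e (lemma u (ι d) (ι κ))) (≈-sym (residue-≈ (ι κ - ι d)))
        where
        lemma : ∀ u d κ → u - (κ - d) ≡ u + d - κ
        lemma = solve-∀
      sound : F ((z , e′) , a) ((z , e′) , a) ((y , e) , d) ≡ (ρ , κ)
      sound = F-diagonal⁺ z e′ a (y , e) d (z-into e′)
                (residue⁺ (twice e′ a + ι d) (from-t (proj₁ (proj₁ (proj₂ (ε-into t w))))))
      coloured : c ((z , e′) , a) ((y , e) , d) ≡ b
      coloured = sym (trans (xor-solve₃ σ (ε e d) b (sym (proj₂ (proj₁ (proj₂ (ε-into t w))))))
                            (cong (σ xor_) (xor-comm (ε e d) (ε e′ a))))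
      same : ∀ {x e″ a′} → z ≡ x → twice e″ a′ ≈ ι t → c ((x , e″) , a′) ((y , e) , d) ≡ b →
             ((z , e′) , a) ≡ ((x , e″) , a′)
      same {e″ = e″} {a′} refl ≈t ceq =
        cong (λ ea → (z , proj₁ ea) , proj₂ ea) (ea-unique (≈t , xor-solve₂ σ (ε e″ a′) (ε e d) ceq))
      unique : ∀ {P} → F P P ((y , e) , d) ≡ (ρ , κ) × c P ((y , e) , d) ≡ b → ((z , e′) , a) ≡ P
      unique {(x , e″) , a′} (Feq , ceq) with feq , keq ← F-diagonal⁻ x e″ a′ (y , e) d Feq =
        same (z-unique x e″ feq) (to-t (residue⁻ (twice e″ a′ + ι d) keq)) ceq

  inflate : ColouredCube {V = V} {R = R} (line ∘ proj₁ ∘ proj₁) (line ∘ proj₁)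
  inflate = record
    { F        = F
    ; c        = c
    ; F-swap₁₂ = F-swap₁₂
    ; F-swap₂₃ = F-swap₂₃
    ; F-two    = F-two
    ; closed   = λ {P} {Q} {S} → closed (proj₁ P) (proj₁ Q) (proj₁ S)
    ; closed⁻  = λ {P} {Q} {S} → closed⁻ (proj₁ P) (proj₁ Q) (proj₁ S)
    ; apart    = λ {P} {Q} → apart (proj₁ P) (proj₁ Q)
    ; out      = λ {P} {r} → F-out P r
    ; into     = λ {Q} {r} → F-into Q r
    ; c-anti   = λ { {(_ , e) , a} {(_ , e′) , b} l≢ → xor-anti (ε e a) (ε e′ b) (s-anti l≢) }
    }

-- Latin cubes and the averaging cube.

record LatinCube {N Λ : Set} (line : N → Λ) : Set where
  field
    g        : N → N → N → N
    g-swap₁₂ : ∀ x y z → g x y z ≡ g y x z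
    g-swap₂₃ : ∀ x y z → g x y z ≡ g x z y
    g-one    : ∀ x y r → ∃ λ z → g x y z ≡ r × (∀ z′ → g x y z′ ≡ r → z ≡ z′)
    closed   : ∀ x y z → line x ≡ line y → line x ≡ line z → line (g x y z) ≡ line x
    closed⁻  : ∀ x y z → line x ≡ line y → line (g x y z) ≡ line x → line z ≡ line x
    apart    : ∀ x y → line (g x x y) ≡ line y → line x ≡ line y
    into     : ∀ y r → line y ≢ line r → ∃ λ x → g x x y ≡ r × (∀ x′ → g x′ x′ y ≡ r → x ≡ x′)

-- Ignoring the ℤ₂-coordinates turns the unique solution of the Latin cube into two. `out` is
-- `g-one` with its first two arguments equal.
double : ∀ {N Λ : Set} {line : N → Λ} → LatinCube line → DoubleCube line
double {N} L = record
  { f        = λ p q s → g (proj₁ p) (proj₁ q) (proj₁ s)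
  ; f-swap₁₂ = λ p q s → g-swap₁₂ (proj₁ p) (proj₁ q) (proj₁ s)
  ; f-swap₂₃ = λ p q s → g-swap₂₃ (proj₁ p) (proj₁ q) (proj₁ s)
  ; f-two    = λ p q r → two (g-one (proj₁ p) (proj₁ q) r)
  ; closed   = λ p q s → closed (proj₁ p) (proj₁ q) (proj₁ s)
  ; closed⁻  = λ p q s → closed⁻ (proj₁ p) (proj₁ q) (proj₁ s)
  ; apart    = λ p q → apart (proj₁ p) (proj₁ q)
  ; out      = λ p r _ → case g-one (proj₁ p) (proj₁ p) r of λ
      { (z , eq , unique) → z , (λ _ → eq) , λ y _ → unique y }
  ; into     = λ q r q∉ → case into (proj₁ q) r q∉ of λ
      { (x , eq , unique) → x , (λ _ → eq) , λ y _ → unique y }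
  }
  where
  open LatinCube L
  two : ∀ {x y r} → (∃ λ z → g x y z ≡ r × (∀ z′ → g x y z′ ≡ r → z ≡ z′)) →
        Two (λ (s : N × Bool) → g x y (proj₁ s) ≡ r)
  two (z , eq , unique) = (z , false) , (z , true) , (λ ()) , eq , eq ,
    λ { (z′ , false) eq′ → inj₁ (cong (_, false) (sym (unique z′ eq′)))
      ; (z′ , true)  eq′ → inj₂ (cong (_, true) (sym (unique z′ eq′))) }

module _ (m : ℕ) .{{_ : NonZero m}} where
  open Modulo m
  open ℤ using (+_; _+_; _*_; _-_; -_)
  open ℤ-Solver using (solve-∀)

  -- `u` and `w` are inverses of 3 and 2. The value r of the cube is given by x + y + z ≡ 3r; with
  -- equal arguments this returns the argument, so one-point lines are closed. Halving gives `apart`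
  -- and solves 2x ≡ 3r - y for `into`.
  averageCube : ∀ u w → u * + 3 ≈ + 1 → w * + 2 ≈ + 1 → LatinCube {Fin m} id
  averageCube u w 3u≈1 2w≈1 = record
    { g        = g
    ; g-swap₁₂ = λ x y z → cong residue (comm₁₂ u (ι x) (ι y) (ι z))
    ; g-swap₂₃ = λ x y z → cong residue (comm₂₃ u (ι x) (ι y) (ι z))
    ; g-one    = λ x y r → let z₀ = residue (+ 3 * ι r - ι x - ι y) in z₀ ,
        g⁺ x y z₀ (≈-shift (residue-≈ (+ 3 * ι r - ι x - ι y)) (solve-z (ι x) (ι y) (ι r) (ι z₀))) ,
        λ z eq → residue⁺ (+ 3 * ι r - ι x - ι y) (≈-shift (≈-sym (g⁻ x y z eq)) (check-z (ι x) (ι y) (ι r) (ι z)))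
    ; closed   = λ { x .x .x refl refl → g⁺ x x x (≈-shift (≈-refl {+ 0}) (triple (ι x))) }
    ; closed⁻  = λ { x .x z refl eq → ι-injective (≈-shift (g⁻ x x z eq) (cancel (ι x) (ι z))) }
    ; apart    = λ x y eq → ι-injective (≈-combine w (ι y - ι x) (g⁻ x x y eq) 2w≈1 (halve (ι x) (ι y) w))
    ; into     = λ y r _ → let x₀ = residue (w * (+ 3 * ι r - ι y)) in x₀ ,
        g⁺ x₀ x₀ y (≈-combine (+ 2) (+ 3 * ι r - ι y) (residue-≈ (w * (+ 3 * ι r - ι y))) 2w≈1
          (solve-x (ι x₀) (ι y) (ι r) w)) ,
        λ x eq → residue⁺ (w * (+ 3 * ι r - ι y))
          (≈-combine (- w) (ι x) (g⁻ x x y eq) 2w≈1 (check-x (ι x) (ι y) (ι r) w))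
    }
    where
    g : Fin m → Fin m → Fin m → Fin m
    g x y z = residue (u * (ι x + ι y + ι z))
    g⁺ : ∀ x y z {r} → ι x + ι y + ι z ≈ + 3 * ι r → g x y z ≡ r
    g⁺ x y z {r} e = residue⁺ (u * (ι x + ι y + ι z)) (≈-combine u (ι r) e 3u≈1 (lemma (ι x + ι y + ι z) (ι r) u))
      where
      lemma : ∀ t r u → u * t - r ≡ u * (t - + 3 * r) + r * (u * + 3 - + 1)
      lemma = solve-∀
    g⁻ : ∀ x y z {r} → g x y z ≡ r → ι x + ι y + ι z ≈ + 3 * ι r
    g⁻ x y z {r} eq = ≈-combine (+ 3) (- t) (residue⁻ (u * t) eq) 3u≈1 (lemma t (ι r) u)
      where
      t = ι x + ι y + ι z
      lemma : ∀ t r u → t - + 3 * r ≡ + 3 * (u * t - r) + - t * (u * + 3 - + 1)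
      lemma = solve-∀
    comm₁₂ : ∀ u x y z → u * (x + y + z) ≡ u * (y + x + z)
    comm₁₂ = solve-∀
    comm₂₃ : ∀ u x y z → u * (x + y + z) ≡ u * (x + z + y)
    comm₂₃ = solve-∀
    solve-z : ∀ x y r z → x + y + z - + 3 * r ≡ z - (+ 3 * r - x - y)
    solve-z = solve-∀
    check-z : ∀ x y r z → + 3 * r - x - y - z ≡ + 3 * r - (x + y + z)
    check-z = solve-∀
    triple : ∀ x → x + x + x - + 3 * x ≡ + 0 - + 0
    triple = solve-∀
    cancel : ∀ x z → z - x ≡ x + x + z - + 3 * x
    cancel = solve-∀
    halve : ∀ x y w → x - y ≡ w * (x + x + y - + 3 * y) + (y - x) * (w * + 2 - + 1)
    halve = solve-∀
    solve-x : ∀ x y r w → x + x + y - + 3 * r ≡ + 2 * (x - w * (+ 3 * r - y)) + (+ 3 * r - y) * (w * + 2 - + 1)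
    solve-x = solve-∀
    check-x : ∀ x y r w → w * (+ 3 * r - y) - x ≡ - w * (x + x + y - + 3 * r) + x * (w * + 2 - + 1)
    check-x = solve-∀

-- Cubes on nine and on four points, verified by exhaustive search.

Exhaustible : Set → Set₁
Exhaustible A = {P : A → Set} → Decidable P → Dec (∃ P)

exhaust-Bool : Exhaustible Bool
exhaust-Bool P? = map′ [ (false ,_) , (true ,_) ]′ (λ { (false , p) → inj₁ p ; (true , p) → inj₂ p })
                       (P? false ⊎-dec P? true)

exhaust-× : ∀ {A B} → Exhaustible A → Exhaustible B → Exhaustible (A × B)
exhaust-× exA exB P? = map′ (λ { (a , b , p) → (a , b) , p }) (λ { ((a , b) , p) → a , b , p })
                            (exA λ a → exB λ b → P? (a , b))

every? : ∀ {A} → Exhaustible A → {P : A → Set} → Decidable P → Dec (∀ a → P a)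
every? exA P? = map′ (λ ¬∃ a → decidable-stable (P? a) (¬∃ ∘ (a ,_))) (λ ∀P (a , ¬p) → ¬p (∀P a))
                     (¬? (exA (¬? ∘ P?)))

N₉ : Set
N₉ = Fin 3 × Fin 3

exhaust₉ : Exhaustible N₉
exhaust₉ = exhaust-× any? any?

_≟₉_ : DecidableEquality N₉
_≟₉_ = ≡-dec _≟ᶠ_ _≟ᶠ_

-- Points are (line, position).  Counting forces the value of two different points of line i and a point of line k onto
-- line k, and of a repeated point of line i and a point of line k onto the third line; the positions are a solution
-- that is affine on each of these cases.
nine-pair : (i x y k z : Fin 3) → N₉
nine-pair i x y k z with toℕ i | toℕ k | toℕ x | toℕ y | toℕ z | x ≟ᶠ y
... | i′ | k′ | x′ | y′ | z′ | yes _ =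
  (2 ℕ.* (i′ ℕ.+ k′)) mod 3 , ((k′ ℕ.+ 2 ℕ.* i′) ℕ.* (z′ ℕ.+ 2 ℕ.* x′ ℕ.+ 1)) mod 3
... | i′ | k′ | x′ | y′ | z′ | no _  =
  k , ((i′ ℕ.+ 2 ℕ.* k′) ℕ.* (k′ ℕ.+ 2 ℕ.* (x′ ℕ.+ y′ ℕ.+ z′))) mod 3

-- Two points on a common line and one off it reduce to `nine-pair` after a permutation. On three
-- different lines the sum of the positions selects the line of the value, so that two positions and
-- this line determine the third position; weighting each position by its own line keeps the formula
-- symmetric.
nine : N₉ → N₉ → N₉ → N₉
nine (i , x) (j , y) (k , z) with i ≟ᶠ j | j ≟ᶠ k | i ≟ᶠ k
... | yes _ | yes _ | _     = i , (toℕ x ℕ.+ toℕ y ℕ.+ toℕ z) mod 3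
... | yes _ | no _  | _     = nine-pair i x y k z
... | no _  | yes _ | _     = nine-pair j y z i x
... | no _  | no _  | yes _ = nine-pair i x z j y
... | no _  | no _  | no _  =
  t , (toℕ t ℕ.* toℕ t ℕ.+ 2 ℕ.* (toℕ i ℕ.* toℕ x ℕ.+ toℕ j ℕ.* toℕ y ℕ.+ toℕ k ℕ.* toℕ z)) mod 3
  where
  t : Fin 3
  t = (toℕ x ℕ.+ toℕ y ℕ.+ toℕ z) mod 3

nineCube : LatinCube {N₉} {Fin 3} proj₁
nineCube = record
  { g        = nine
  ; g-swap₁₂ = from-yes (∀₉ λ x → ∀₉ λ y → ∀₉ λ z → nine x y z ≟₉ nine y x z)
  ; g-swap₂₃ = from-yes (∀₉ λ x → ∀₉ λ y → ∀₉ λ z → nine x y z ≟₉ nine x z y)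
  ; g-one    = from-yes (∀₉ λ x → ∀₉ λ y → ∀₉ λ r → exhaust₉ λ z →
                 (nine x y z ≟₉ r) ×-dec ∀₉ λ z′ → (nine x y z′ ≟₉ r) →-dec (z ≟₉ z′))
  ; closed   = from-yes (∀₉ λ x → ∀₉ λ y → ∀₉ λ z → (proj₁ x ≟ᶠ proj₁ y) →-dec (proj₁ x ≟ᶠ proj₁ z) →-dec
                 (proj₁ (nine x y z) ≟ᶠ proj₁ x))
  ; closed⁻  = from-yes (∀₉ λ x → ∀₉ λ y → ∀₉ λ z → (proj₁ x ≟ᶠ proj₁ y) →-dec
                 (proj₁ (nine x y z) ≟ᶠ proj₁ x) →-dec (proj₁ z ≟ᶠ proj₁ x))
  ; apart    = from-yes (∀₉ λ x → ∀₉ λ y → (proj₁ (nine x x y) ≟ᶠ proj₁ y) →-dec (proj₁ x ≟ᶠ proj₁ y))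
  ; into     = from-yes (∀₉ λ y → ∀₉ λ r → ¬? (proj₁ y ≟ᶠ proj₁ r) →-dec exhaust₉ λ x →
                 (nine x x y ≟₉ r) ×-dec ∀₉ λ x′ → (nine x′ x′ y ≟₉ r) →-dec (x ≟₉ x′))
  }
  where
  ∀₉ : {P : N₉ → Set} → Decidable P → Dec (∀ x → P x)
  ∀₉ = every? exhaust₉

-- The field with four elements: (a , b) stands for a + bω.
F₄ : Set
F₄ = Bool × Bool

infixl 6 _⊕_
infixl 7 _⊗_
_⊕_ _⊗_ : F₄ → F₄ → F₄
(a , b) ⊕ (c , d) = a xor c , b xor d
(a , b) ⊗ (c , d) = (a ∧ c) xor (b ∧ d) , (a ∧ d) xor (b ∧ c) xor (b ∧ d)

toF₄ : Fin 4 → F₄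
toF₄ zero                  = false , false
toF₄ (suc zero)            = true , false
toF₄ (suc (suc zero))      = false , true
toF₄ (suc (suc (suc zero))) = true , true

fromF₄ : F₄ → Fin 4
fromF₄ (false , false) = zero
fromF₄ (true , false)  = suc zero
fromF₄ (false , true)  = suc (suc zero)
fromF₄ (true , true)   = suc (suc (suc zero))

-- x + y + z + ω² ((xy)² + (yz)² + (zx)² + o), where o is the argument whose ℤ₂-coordinate differs from the other two,
-- or x + y + z if there is none.  It is equivariant under the affine maps of 𝔽₄, and its restrictions to equal and to
-- mixed ℤ₂-coordinates are, for x ≠ y, 2-to-1 in z with complementary images.
four : Fin 4 × Bool → Fin 4 × Bool → Fin 4 × Bool → Fin 4
four (i , a) (j , b) (k , c) =
  fromF₄ (x ⊕ y ⊕ z ⊕ (true , true) ⊗ (xy ⊗ xy ⊕ yz ⊗ yz ⊕ zx ⊗ zx ⊕ odd-one-out a b c))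
  where
  x y z xy yz zx : F₄
  x = toF₄ i
  y = toF₄ j
  z = toF₄ k
  xy = x ⊗ y
  yz = y ⊗ z
  zx = z ⊗ x
  odd-one-out : Bool → Bool → Bool → F₄
  odd-one-out false false false = x ⊕ y ⊕ z
  odd-one-out true  true  true  = x ⊕ y ⊕ z
  odd-one-out false false true  = z
  odd-one-out true  true  false = z
  odd-one-out false true  false = y
  odd-one-out true  false true  = y
  odd-one-out true  false false = x
  odd-one-out false true  true  = x

fourCube : DoubleCube {Fin 4} id
fourCube = record
  { f        = four
  ; f-swap₁₂ = from-yes (∀₈ λ p → ∀₈ λ q → ∀₈ λ s → four p q s ≟ᶠ four q p s)
  ; f-swap₂₃ = from-yes (∀₈ λ p → ∀₈ λ q → ∀₈ λ s → four p q s ≟ᶠ four p s q)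
  -- The conditions are reordered so that the first solution is tested before the search for the
  -- second begins.
  ; f-two    = from-yes (∀₈ λ p → ∀₈ λ q → ∀₄ λ r → map′
                 (λ { (s , s≡r , t , t≡r , s≢t , all) → s , t , s≢t , s≡r , t≡r , all })
                 (λ { (s , t , s≢t , s≡r , t≡r , all) → s , s≡r , t , t≡r , s≢t , all })
                 (exhaust₈ λ s → (four p q s ≟ᶠ r) ×-dec exhaust₈ λ t → (four p q t ≟ᶠ r) ×-dec ¬? (s ≟₈ t) ×-dec
                   ∀₈ λ c → (four p q c ≟ᶠ r) →-dec ((c ≟₈ s) ⊎-dec (c ≟₈ t))))
  ; closed   = from-yes (∀₈ λ p → ∀₈ λ q → ∀₈ λ s → (proj₁ p ≟ᶠ proj₁ q) →-dec (proj₁ p ≟ᶠ proj₁ s) →-dec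
                 (four p q s ≟ᶠ proj₁ p))
  ; closed⁻  = from-yes (∀₈ λ p → ∀₈ λ q → ∀₈ λ s → (proj₁ p ≟ᶠ proj₁ q) →-dec (four p q s ≟ᶠ proj₁ p) →-dec
                 (proj₁ s ≟ᶠ proj₁ p))
  ; apart    = from-yes (∀₈ λ p → ∀₈ λ q → (four p p q ≟ᶠ proj₁ q) →-dec (proj₁ p ≟ᶠ proj₁ q))
  ; out      = from-yes (∀₈ λ p → ∀₄ λ r → ¬? (proj₁ p ≟ᶠ r) →-dec any? λ z →
                 (∀ᵇ λ e → four p p (z , e) ≟ᶠ r) ×-dec ∀₄ λ y → ∀ᵇ λ e → (four p p (y , e) ≟ᶠ r) →-dec (z ≟ᶠ y))
  ; into     = from-yes (∀₈ λ q → ∀₄ λ r → ¬? (proj₁ q ≟ᶠ r) →-dec any? λ x →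
                 (∀ᵇ λ e → four (x , e) (x , e) q ≟ᶠ r) ×-dec
                 ∀₄ λ y → ∀ᵇ λ e → (four (y , e) (y , e) q ≟ᶠ r) →-dec (x ≟ᶠ y))
  }
  where
  exhaust₈ : Exhaustible (Fin 4 × Bool)
  exhaust₈ = exhaust-× any? exhaust-Bool
  _≟₈_ : DecidableEquality (Fin 4 × Bool)
  _≟₈_ = ≡-dec _≟ᶠ_ _≟ᵇ_
  ∀₈ : {P : Fin 4 × Bool → Set} → Decidable P → Dec (∀ p → P p)
  ∀₈ = every? exhaust₈
  ∀₄ : {P : Fin 4 → Set} → Decidable P → Dec (∀ r → P r)
  ∀₄ = every? any?
  ∀ᵇ : {P : Bool → Set} → Decidable P → Dec (∀ e → P e)
  ∀ᵇ = every? exhaust-Bool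

-- Counting in the list of all subsets.

open import Data.Fin.Subset as Subset using (Subset; _∈_; _∉_; ∣_∣; ⁅_⁆; _∪_; inside; outside)
open import Data.Fin.Subset.Properties
  using (_∈?_; x∈⁅x⁆; x∈⁅y⁆⇒x≡y; ∣⁅x⁆∣≡1; ∣⊥∣≡0; ⊆-antisym; x∈p∪q⁺; x∈p∪q⁻; ∉⊥; ∪-identityˡ)
open import Data.List as List using (List; _++_; length; filter; map; allFin)
open import Data.List.Membership.Propositional using () renaming (_∈_ to _∈ₗ_)
open import Data.List.Membership.Propositional.Properties
  using (∈-filter⁺; ∈-filter⁻; ∈-++⁺ˡ; ∈-++⁺ʳ; ∈-map⁺)
open import Data.List.Properties using (filter-++; length-++; filter-≐; map-tabulate)
open import Data.List.Relation.Unary.Any using (here; there)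
open import Data.Nat using (_+_; _*_; _/_)
open import Data.Nat.ListAction using (sum)
open import Data.Nat.Tactic.RingSolver using (solve-∀)
open import Data.Vec using ([]; _∷_; here; there)
open import Data.Vec.Properties using (∷-injective; ∷-injectiveʳ)

count : {A : Set} {P : Pred A 0ℓ} → Decidable P → List A → ℕ
count P? xs = length (filter P? xs)

count-none : ∀ {A : Set} {P : Pred A 0ℓ} (P? : Decidable P) xs → (∀ x → ¬ P x) → count P? xs ≡ 0
count-none P? []       ¬P = refl
count-none P? (x ∷ xs) ¬P with P? x
... | yes p = ⊥-elim (¬P x p)
... | no _  = count-none P? xs ¬P

count-⊎ : ∀ {A : Set} {P Q S : Pred A 0ℓ} (P? : Decidable P) (Q? : Decidable Q) (S? : Decidable S) →
          (∀ x → Q x → P x) → (∀ x → S x → P x) → (∀ x → P x → Q x ⊎ S x) →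
          (∀ x → Q x → ¬ S x) → ∀ xs → count P? xs ≡ count Q? xs + count S? xs
count-⊎ P? Q? S? Q⇒P S⇒P P⇒Q⊎S Q∩S=∅ [] = refl
count-⊎ P? Q? S? Q⇒P S⇒P P⇒Q⊎S Q∩S=∅ (x ∷ xs)
  with ih ← count-⊎ P? Q? S? Q⇒P S⇒P P⇒Q⊎S Q∩S=∅ xs | P? x | Q? x | S? x
... | yes p | yes q | yes s = ⊥-elim (Q∩S=∅ x q s)
... | yes p | yes q | no ¬s = cong suc ih
... | yes p | no ¬q | yes s = trans (cong suc ih) (sym (ℕₚ.+-suc _ _))
... | yes p | no ¬q | no ¬s = ⊥-elim ([ ¬q , ¬s ]′ (P⇒Q⊎S x p))
... | no ¬p | yes q | _     = ⊥-elim (¬p (Q⇒P x q))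
... | no ¬p | no ¬q | yes s = ⊥-elim (¬p (S⇒P x s))
... | no ¬p | no ¬q | no ¬s = ih

count-cong : ∀ {A : Set} {P Q : Pred A 0ℓ} (P? : Decidable P) (Q? : Decidable Q) →
             (∀ x → P x → Q x) → (∀ x → Q x → P x) → ∀ xs → count P? xs ≡ count Q? xs
count-cong P? Q? P⇒Q Q⇒P xs = cong length (filter-≐ P? Q? ((λ {x} → P⇒Q x) , (λ {x} → Q⇒P x)) xs)

count-filter : ∀ {A : Set} {P Q : Pred A 0ℓ} (P? : Decidable P) (Q? : Decidable Q) xs →
               count P? (filter Q? xs) ≡ count (λ x → P? x ×-dec Q? x) xs
count-filter P? Q? []       = refl
count-filter P? Q? (x ∷ xs) with Q? x
... | no _ with P? x
...   | yes _ = count-filter P? Q? xs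
...   | no _  = count-filter P? Q? xs
count-filter P? Q? (x ∷ xs) | yes _ with P? x
...   | yes _ = cong suc (count-filter P? Q? xs)
...   | no _  = count-filter P? Q? xs

count-accept : ∀ {A : Set} {P : Pred A 0ℓ} (P? : Decidable P) {x} → P x → ∀ xs →
               count P? (x ∷ xs) ≡ suc (count P? xs)
count-accept P? {x} p xs with P? x
... | yes _ = refl
... | no ¬p = ⊥-elim (¬p p)

count-reject : ∀ {A : Set} {P : Pred A 0ℓ} (P? : Decidable P) {x} → ¬ P x → ∀ xs →
               count P? (x ∷ xs) ≡ count P? xs
count-reject P? {x} ¬p xs with P? x
... | yes p = ⊥-elim (¬p p)
... | no _  = refl

subsets : ∀ n → List (Subset n)
subsets zero    = [] ∷ []
subsets (suc n) = map (inside ∷_) (subsets n) ++ map (outside ∷_) (subsets n)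

∈-subsets : ∀ {n} (B : Subset n) → B ∈ₗ subsets n
∈-subsets []            = here refl
∈-subsets (inside ∷ B)  = ∈-++⁺ˡ (∈-map⁺ (inside ∷_) (∈-subsets B))
∈-subsets (outside ∷ B) = ∈-++⁺ʳ (map (inside ∷_) (subsets _)) (∈-map⁺ (outside ∷_) (∈-subsets B))

mult-map-same : ∀ {n} s (B : Subset n) bs → mult (s ∷ B) (map (s ∷_) bs) ≡ mult B bs
mult-map-same s B []       = refl
mult-map-same s B (C ∷ bs) = case B ≟B C of λ
  { (yes refl) → begin
      mult (s ∷ B) (map (s ∷_) (B ∷ bs))  ≡⟨ count-accept ((s ∷ B) ≟B_) refl (map (s ∷_) bs) ⟩
      suc (mult (s ∷ B) (map (s ∷_) bs))  ≡⟨ cong suc (mult-map-same s B bs) ⟩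
      suc (mult B bs)                     ≡⟨ sym (count-accept (B ≟B_) refl bs) ⟩
      mult B (B ∷ bs)                     ∎
  ; (no B≢C) → begin
      mult (s ∷ B) (map (s ∷_) (C ∷ bs))  ≡⟨ count-reject ((s ∷ B) ≟B_) (B≢C ∘ ∷-injectiveʳ) (map (s ∷_) bs) ⟩
      mult (s ∷ B) (map (s ∷_) bs)        ≡⟨ mult-map-same s B bs ⟩
      mult B bs                           ≡⟨ sym (count-reject (B ≟B_) B≢C bs) ⟩
      mult B (C ∷ bs)                     ∎
  }
  where open ≡-Reasoning

mult-map-other : ∀ {n s t} → s ≢ t → (B : Subset n) → ∀ bs → mult (s ∷ B) (map (t ∷_) bs) ≡ 0
mult-map-other s≢t B []       = refl
mult-map-other {s = s} {t} s≢t B (C ∷ bs) =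
  trans (count-reject ((s ∷ B) ≟B_) {t ∷ C} (s≢t ∘ proj₁ ∘ ∷-injective) (map (t ∷_) bs)) (mult-map-other s≢t B bs)

-- Turns list counts into numbers of solutions: filtering the list of all subsets by a predicate
-- leaves each solution once.
mult-subsets : ∀ {n} (B : Subset n) → mult B (subsets n) ≡ 1
mult-subsets []      = refl
mult-subsets (s ∷ B) = begin
  mult (s ∷ B) (map (inside ∷_) bs ++ map (outside ∷_) bs)
    ≡⟨ cong length (filter-++ ((s ∷ B) ≟B_) (map (inside ∷_) bs) (map (outside ∷_) bs)) ⟩
  length (filter ((s ∷ B) ≟B_) (map (inside ∷_) bs) ++ filter ((s ∷ B) ≟B_) (map (outside ∷_) bs))
    ≡⟨ length-++ (filter ((s ∷ B) ≟B_) (map (inside ∷_) bs)) ⟩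
  mult (s ∷ B) (map (inside ∷_) bs) + mult (s ∷ B) (map (outside ∷_) bs)
    ≡⟨ halves s ⟩
  1 ∎
  where
  open ≡-Reasoning
  bs = subsets _
  halves : ∀ s → mult (s ∷ B) (map (inside ∷_) bs) + mult (s ∷ B) (map (outside ∷_) bs) ≡ 1
  halves inside  = cong₂ _+_ (trans (mult-map-same inside B bs) (mult-subsets B)) (mult-map-other (λ ()) B bs)
  halves outside = cong₂ _+_ (mult-map-other (λ ()) B bs) (trans (mult-map-same outside B bs) (mult-subsets B))

count-one : ∀ {n} {P : Pred (Subset n) 0ℓ} (P? : Decidable P) B → P B → (∀ C → P C → C ≡ B) →
            count P? (subsets n) ≡ 1
count-one P? B p unique =
  trans (count-cong P? (B ≟B_) (λ C → sym ∘ unique C) (λ { C refl → p }) (subsets _)) (mult-subsets B)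

count-two : ∀ {n} {P : Pred (Subset n) 0ℓ} (P? : Decidable P) → Two P → count P? (subsets n) ≡ 2
count-two P? (A , B , A≢B , p , q , complete) =
  trans (count-⊎ P? (A ≟B_) (B ≟B_) (λ { C refl → p }) (λ { C refl → q })
                 (λ C → map⊎ sym sym ∘ complete C) (λ { C refl B≡A → A≢B (sym B≡A) }) (subsets _))
        (cong₂ _+_ (mult-subsets A) (mult-subsets B))

∣⁅x⁆∪p∣ : ∀ {n} (x : Fin n) (p : Subset n) → x ∉ p → ∣ ⁅ x ⁆ ∪ p ∣ ≡ suc ∣ p ∣
∣⁅x⁆∪p∣ zero    (inside  ∷ p) x∉p = ⊥-elim (x∉p here)
∣⁅x⁆∪p∣ zero    (outside ∷ p) x∉p = cong (suc ∘ ∣_∣) (∪-identityˡ p)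
∣⁅x⁆∪p∣ (suc x) (inside  ∷ p) x∉p = cong suc (∣⁅x⁆∪p∣ x p (x∉p ∘ there))
∣⁅x⁆∪p∣ (suc x) (outside ∷ p) x∉p = ∣⁅x⁆∪p∣ x p (x∉p ∘ there)

image : ∀ {n k} → (Fin k → Fin n) → Subset n
image {k = zero}  g = Subset.⊥
image {k = suc k} g = ⁅ g zero ⁆ ∪ image (g ∘ suc)

∈-image⁺ : ∀ {n k} (g : Fin k → Fin n) i → g i ∈ image g
∈-image⁺ g zero    = x∈p∪q⁺ (inj₁ (x∈⁅x⁆ (g zero)))
∈-image⁺ g (suc i) = x∈p∪q⁺ {p = ⁅ g zero ⁆} (inj₂ (∈-image⁺ (g ∘ suc) i))

∈-image⁻ : ∀ {n k} (g : Fin k → Fin n) {x} → x ∈ image g → ∃ λ i → g i ≡ x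
∈-image⁻ {k = zero}  g x∈ = ⊥-elim (∉⊥ x∈)
∈-image⁻ {k = suc k} g x∈ with x∈p∪q⁻ ⁅ g zero ⁆ (image (g ∘ suc)) x∈
... | inj₁ x∈⁅⁆ = zero , sym (x∈⁅y⁆⇒x≡y (g zero) x∈⁅⁆)
... | inj₂ x∈im with i , eq ← ∈-image⁻ (g ∘ suc) x∈im = suc i , eq

∣image∣ : ∀ {n k} (g : Fin k → Fin n) → (∀ {i j} → g i ≡ g j → i ≡ j) → ∣ image g ∣ ≡ k
∣image∣ {n} {zero}  g inj = ∣⊥∣≡0 n
∣image∣ {n} {suc k} g inj = trans
  (∣⁅x⁆∪p∣ (g zero) (image (g ∘ suc)) λ g0∈ → case inj (proj₂ (∈-image⁻ (g ∘ suc) g0∈)) of λ ())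
  (cong suc (∣image∣ (g ∘ suc) λ eq → case inj eq of λ { refl → refl }))

-- Serves for the total multiplicity of a block, which is 2 on each of the `d` systems of a large
-- block and 1 on the only system of a triple.
sum-const-on : ∀ {m} c (S : Subset m) (f : Fin m → ℕ) → (∀ r → r ∈ S → f r ≡ c) → (∀ r → r ∉ S → f r ≡ 0) →
               sum (map f (allFin m)) ≡ ∣ S ∣ * c
sum-const-on {zero}  c [] f on off = refl
sum-const-on {suc m} c (s ∷ S) f on off = begin
  f zero + sum (map f (List.tabulate suc))  ≡⟨ cong (λ xs → f zero + sum xs) shift ⟩
  f zero + sum (map (f ∘ suc) (allFin m))   ≡⟨ cong (f zero +_) ih ⟩
  f zero + ∣ S ∣ * c                         ≡⟨ head s on off ⟩
  ∣ s ∷ S ∣ * c                              ∎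
  where
  open ≡-Reasoning
  shift : map f (List.tabulate suc) ≡ map (f ∘ suc) (allFin m)
  shift = trans (map-tabulate suc f) (sym (map-tabulate id (f ∘ suc)))
  ih = sum-const-on c S (f ∘ suc) (λ r → on (suc r) ∘ there) (λ r r∉S → off (suc r) λ { (there r∈S) → r∉S r∈S })
  head : ∀ s → (∀ r → r ∈ s ∷ S → f r ≡ c) → (∀ r → r ∉ s ∷ S → f r ≡ 0) → f zero + ∣ S ∣ * c ≡ ∣ s ∷ S ∣ * c
  head inside  on off = cong (_+ ∣ S ∣ * c) (on zero here)
  head outside on off = cong (_+ ∣ S ∣ * c) (off zero λ ())

-- From a hole system to an LS*.

triple : ∀ {v} → Fin v → Fin v → Fin v → Block v
triple x y z = ⁅ x ⁆ ∪ (⁅ y ⁆ ∪ ⁅ z ⁆)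

module _ {v : ℕ} where

  ∈-triple₁ : ∀ (x y z : Fin v) → x ∈ triple x y z
  ∈-triple₁ x y z = x∈p∪q⁺ (inj₁ (x∈⁅x⁆ x))

  ∈-triple₂ : ∀ (x y z : Fin v) → y ∈ triple x y z
  ∈-triple₂ x y z = x∈p∪q⁺ {p = ⁅ x ⁆} (inj₂ (x∈p∪q⁺ (inj₁ (x∈⁅x⁆ y))))

  ∈-triple₃ : ∀ (x y z : Fin v) → z ∈ triple x y z
  ∈-triple₃ x y z = x∈p∪q⁺ {p = ⁅ x ⁆} (inj₂ (x∈p∪q⁺ {p = ⁅ y ⁆} (inj₂ (x∈⁅x⁆ z))))

  ∈-triple⁻ : ∀ {w} (x y z : Fin v) → w ∈ triple x y z → w ≡ x ⊎ w ≡ y ⊎ w ≡ z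
  ∈-triple⁻ x y z w∈ =
    map⊎ (x∈⁅y⁆⇒x≡y x) (map⊎ (x∈⁅y⁆⇒x≡y y) (x∈⁅y⁆⇒x≡y z) ∘ x∈p∪q⁻ ⁅ y ⁆ ⁅ z ⁆)
         (x∈p∪q⁻ ⁅ x ⁆ (⁅ y ⁆ ∪ ⁅ z ⁆) w∈)

  triple-⊆ : ∀ (x y z : Fin v) {B} → x ∈ B → y ∈ B → z ∈ B → ∀ {w} → w ∈ triple x y z → w ∈ B
  triple-⊆ x y z x∈ y∈ z∈ w∈ with ∈-triple⁻ x y z w∈
  ... | inj₁ refl        = x∈
  ... | inj₂ (inj₁ refl) = y∈
  ... | inj₂ (inj₂ refl) = z∈

  triple-swap₁₂ : ∀ (x y z : Fin v) → triple x y z ≡ triple y x z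
  triple-swap₁₂ x y z = ⊆-antisym (triple-⊆ x y z (∈-triple₂ y x z) (∈-triple₁ y x z) (∈-triple₃ y x z))
                                  (triple-⊆ y x z (∈-triple₂ x y z) (∈-triple₁ x y z) (∈-triple₃ x y z))

  triple-swap₂₃ : ∀ (x y z : Fin v) → triple x y z ≡ triple x z y
  triple-swap₂₃ x y z = ⊆-antisym (triple-⊆ x y z (∈-triple₁ x z y) (∈-triple₃ x z y) (∈-triple₂ x z y))
                                  (triple-⊆ x z y (∈-triple₁ x y z) (∈-triple₃ x y z) (∈-triple₂ x y z))

  ∣triple∣ : ∀ {x y z : Fin v} → x ≢ y → x ≢ z → y ≢ z → ∣ triple x y z ∣ ≡ 3
  ∣triple∣ {x} {y} {z} x≢y x≢z y≢z = trans
    (∣⁅x⁆∪p∣ x (⁅ y ⁆ ∪ ⁅ z ⁆) λ x∈ → [ x≢y ∘ x∈⁅y⁆⇒x≡y y , x≢z ∘ x∈⁅y⁆⇒x≡y z ]′ (x∈p∪q⁻ ⁅ y ⁆ ⁅ z ⁆ x∈))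
    (cong suc (trans (∣⁅x⁆∪p∣ y ⁅ z ⁆ (y≢z ∘ x∈⁅y⁆⇒x≡y z)) (cong suc (∣⁅x⁆∣≡1 z))))

-- A large block has 2 + 2d points and occurs twice in each of the d systems whose hole it is, hence
-- 2d times in all, which is its size less 2. `system₀` ensures that every large block does occur.
module LargeSet
  {v m d : ℕ} {Λ : Set} {On : Λ → Fin v → Set} {hole : Fin m → Λ} (H : HoleSystem On hole)
  (_≟_ : (l l′ : Λ) → Dec (l ≡ l′))
  (block : Λ → Fin (2 + 2 * d) → Fin v) (block-injective : ∀ {l i j} → block l i ≡ block l j → i ≡ j)
  (On⇒block : ∀ {l x} → On l x → ∃ λ i → block l i ≡ x) (block⇒On : ∀ l i → On l (block l i))
  (systems : Λ → Fin d → Fin m) (systems-injective : ∀ {l i j} → systems l i ≡ systems l j → i ≡ j)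
  (hole⇒systems : ∀ r → ∃ λ i → systems (hole r) i ≡ r) (hole-systems : ∀ l i → hole (systems l i) ≡ l)
  (system₀ : Fin d)
  (big-unique : ∀ {l l′ x y z} → x ≢ y → x ≢ z → y ≢ z →
                On l x → On l y → On l z → On l′ x → On l′ y → On l′ z → l ≡ l′)
  where
  open HoleSystem H

  big : Λ → Block v
  big l = image (block l)

  On⇒∈ : ∀ {l x} → On l x → x ∈ big l
  On⇒∈ {l} on with i , refl ← On⇒block on = ∈-image⁺ (block l) i

  ∈⇒On : ∀ {l x} → x ∈ big l → On l x
  ∈⇒On {l} x∈ with i , refl ← ∈-image⁻ (block l) x∈ = block⇒On l i

  ∣big∣ : ∀ l → ∣ big l ∣ ≡ 2 + 2 * d
  ∣big∣ l = ∣image∣ (block l) block-injective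

  distinct₁₃ : ∀ {r x y z} → T r x y z → x ≢ z
  distinct₁₃ = distinct ∘ swap₂₃

  distinct₂₃ : ∀ {r x y z} → T r x y z → y ≢ z
  distinct₂₃ = distinct ∘ swap₂₃ ∘ swap₁₂

  IsTriple : Fin m → Block v → Set
  IsTriple r B = ∃ λ x → ∃ λ y → ∃ λ z → B ≡ triple x y z × T r x y z

  isTriple? : ∀ r → Decidable (IsTriple r)
  isTriple? r B = any? λ x → any? λ y → any? λ z → (B ≟B triple x y z) ×-dec T? r x y z

  triples : Fin m → List (Block v)
  triples r = filter (isTriple? r) (subsets v)

  ℬ : Fin m → List (Block v)
  ℬ r = big (hole r) ∷ big (hole r) ∷ triples r

  -- The symmetries of `T` allow the points of a block to be listed in any order. `second` and
  -- `third` continue this for two and three prescribed points.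
  first : ∀ {r B x} → IsTriple r B → x ∈ B → ∃₂ λ y z → B ≡ triple x y z × T r x y z
  first (a , b , c , refl , t) x∈ with ∈-triple⁻ a b c x∈
  ... | inj₁ refl        = b , c , refl , t
  ... | inj₂ (inj₁ refl) = a , c , triple-swap₁₂ a b c , swap₁₂ t
  ... | inj₂ (inj₂ refl) = a , b , trans (triple-swap₂₃ a b c) (triple-swap₁₂ a c b) , swap₁₂ (swap₂₃ t)

  second : ∀ {r B x y} → IsTriple r B → x ∈ B → y ∈ B → x ≢ y → ∃ λ z → B ≡ triple x y z × T r x y z
  second {x = x} B-triple x∈ y∈ x≢y with first B-triple x∈
  ... | b , c , refl , t with ∈-triple⁻ x b c y∈
  ...   | inj₁ y≡x         = ⊥-elim (x≢y (sym y≡x))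
  ...   | inj₂ (inj₁ refl) = c , refl , t
  ...   | inj₂ (inj₂ refl) = b , triple-swap₂₃ x b c , swap₂₃ t

  third : ∀ {r B x y z} → IsTriple r B → x ∈ B → y ∈ B → z ∈ B → x ≢ y → x ≢ z → y ≢ z →
          B ≡ triple x y z × T r x y z
  third {x = x} {y} B-triple x∈ y∈ z∈ x≢y x≢z y≢z with second B-triple x∈ y∈ x≢y
  ... | c , refl , t with ∈-triple⁻ x y c z∈
  ...   | inj₁ z≡x         = ⊥-elim (x≢z (sym z≡x))
  ...   | inj₂ (inj₁ z≡y)  = ⊥-elim (y≢z (sym z≡y))
  ...   | inj₂ (inj₂ refl) = refl , t

  big-not-triple : ∀ {r l} → ¬ IsTriple r (big l)
  big-not-triple {l = l} (x , y , z , eq , t) = transversal t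
    (l , on (∈-triple₁ x y z) , on (∈-triple₂ x y z) , on (∈-triple₃ x y z))
    where
    on : ∀ {w} → w ∈ triple x y z → On l w
    on w∈ = ∈⇒On (subst (_ ∈_) (sym eq) w∈)

  big-injective : ∀ {l l′} → big l ≡ big l′ → l ≡ l′
  -- Three indices are needed to apply `big-unique`: 0, 1, and a third that exists because `system₀`
  -- shows `d` to be positive.
  big-injective {l} {l′} eq = big-unique (ne λ ()) (ne λ ()) (ne λ ()) (block⇒On l _) (block⇒On l _) (block⇒On l _)
                                         (on zero) (on (suc zero)) (on (suc (suc (inject≤ system₀ (ℕₚ.m≤m+n d _)))))
    where
    ne : ∀ {i j} → i ≢ j → block l i ≢ block l j
    ne i≢j = i≢j ∘ block-injective
    on : ∀ i → On l′ (block l i)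
    on i = ∈⇒On (subst (block l i ∈_) eq (On⇒∈ (block⇒On l i)))

  ∈ℬ⁻ : ∀ {r B} → B ∈ₗ ℬ r → B ≡ big (hole r) ⊎ IsTriple r B
  ∈ℬ⁻ (here eq)          = inj₁ eq
  ∈ℬ⁻ (there (here eq))  = inj₁ eq
  ∈ℬ⁻ (there (there B∈)) = inj₂ (proj₂ (∈-filter⁻ (isTriple? _) {xs = subsets v} B∈))

  ∈ℬ-triple : ∀ {r B} → IsTriple r B → B ∈ₗ ℬ r
  ∈ℬ-triple {r} {B} t = there (there (∈-filter⁺ (isTriple? r) (∈-subsets B) t))

  ∈ℬ-big : ∀ l → InUnion ℬ (big l)
  ∈ℬ-big l = systems l system₀ , here (cong big (sym (hole-systems l system₀)))

  ∣IsTriple∣ : ∀ {r B} → IsTriple r B → ∣ B ∣ ≡ 3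
  ∣IsTriple∣ (x , y , z , refl , t) = ∣triple∣ (distinct t) (distinct₁₃ t) (distinct₂₃ t)

  mult-big : ∀ r → mult (big (hole r)) (ℬ r) ≡ 2
  mult-big r = begin
    mult B (ℬ r)                        ≡⟨ count-accept (B ≟B_) refl _ ⟩
    1 + mult B (B ∷ triples r)          ≡⟨ cong suc (count-accept (B ≟B_) refl _) ⟩
    2 + mult B (triples r)              ≡⟨ cong (2 +_) (count-filter (B ≟B_) (isTriple? r) (subsets v)) ⟩
    2 + count both? (subsets v)
      ≡⟨ cong (2 +_) (count-none both? (subsets v) λ { _ (refl , t) → big-not-triple t }) ⟩
    2                                   ∎
    where
    open ≡-Reasoning
    B = big (hole r)
    both? = λ C → (B ≟B C) ×-dec isTriple? r C

  mult-not-big : ∀ {r B} → B ≢ big (hole r) → mult B (ℬ r) ≡ count (λ C → (B ≟B C) ×-dec isTriple? r C) (subsets v)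
  mult-not-big {r} {B} B≢ = begin
    mult B (ℬ r)                           ≡⟨ count-reject (B ≟B_) B≢ _ ⟩
    mult B (big (hole r) ∷ triples r)      ≡⟨ count-reject (B ≟B_) B≢ _ ⟩
    mult B (triples r)                     ≡⟨ count-filter (B ≟B_) (isTriple? r) (subsets v) ⟩
    count (λ C → (B ≟B C) ×-dec isTriple? r C) (subsets v) ∎
    where open ≡-Reasoning

  total-mult : ∀ B → InUnion ℬ B → sum (map (λ r → mult B (ℬ r)) (allFin m)) ≡ ∣ B ∣ ∸ 2
  total-mult B (r , B∈) with ∈ℬ⁻ B∈
  ... | inj₁ refl = begin
    sum (map (λ s → mult (big l) (ℬ s)) (allFin m))  ≡⟨ sum-const-on 2 (image (systems l)) _ on off ⟩
    ∣ image (systems l) ∣ * 2                         ≡⟨ cong (_* 2) (∣image∣ (systems l) systems-injective) ⟩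
    d * 2                                            ≡⟨ ℕₚ.*-comm d 2 ⟩
    2 * d                                            ≡⟨ cong (_∸ 2) (sym (∣big∣ l)) ⟩
    ∣ big l ∣ ∸ 2                                     ∎
    where
    open ≡-Reasoning
    l = hole r
    on : ∀ s → s ∈ image (systems l) → mult (big l) (ℬ s) ≡ 2
    on s s∈ with i , refl ← ∈-image⁻ (systems l) s∈ =
      subst (λ l′ → mult (big l′) (ℬ (systems l i)) ≡ 2) (hole-systems l i) (mult-big (systems l i))
    off : ∀ s → s ∉ image (systems l) → mult (big l) (ℬ s) ≡ 0
    off s s∉ = trans (mult-not-big λ eq → s∉ (s∈ (big-injective eq)))
                     (count-none _ (subsets v) λ { _ (refl , t) → big-not-triple t })
      where
      s∈ : l ≡ hole s → s ∈ image (systems l)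
      s∈ eq with i , p ← hole⇒systems s =
        subst (_∈ image (systems l)) (trans (cong (λ l′ → systems l′ i) eq) p) (∈-image⁺ (systems l) i)
  ... | inj₂ B-triple@(x , y , z , refl , t) = begin
    sum (map (λ s → mult B (ℬ s)) (allFin m))  ≡⟨ sum-const-on 1 ⁅ r ⁆ _ on off ⟩
    ∣ ⁅ r ⁆ ∣ * 1                               ≡⟨ cong (_* 1) (∣⁅x⁆∣≡1 r) ⟩
    1                                          ≡⟨ cong (_∸ 2) (sym (∣IsTriple∣ B-triple)) ⟩
    ∣ B ∣ ∸ 2                                   ∎
    where
    open ≡-Reasoning
    not-big : ∀ s → B ≢ big (hole s)
    not-big s eq = big-not-triple (subst (IsTriple r) eq B-triple)
    on : ∀ s → s ∈ ⁅ r ⁆ → mult B (ℬ s) ≡ 1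
    on s s∈ with refl ← x∈⁅y⁆⇒x≡y r s∈ = trans (mult-not-big (not-big r))
      (count-one _ B (refl , B-triple) λ _ → sym ∘ proj₁)
    off : ∀ s → s ∉ ⁅ r ⁆ → mult B (ℬ s) ≡ 0
    off s s∉ = trans (mult-not-big (not-big s)) (count-none _ (subsets v) λ { _ (refl , t′) → s∉ (s∈ t′) })
      where
      s∈ : IsTriple s B → s ∈ ⁅ r ⁆
      s∈ t′ = subst (_∈ ⁅ r ⁆) (functional t (proj₂ (third t′ (∈-triple₁ x y z) (∈-triple₂ x y z) (∈-triple₃ x y z)
                    (distinct t) (distinct₁₃ t) (distinct₂₃ t)))) (x∈⁅x⁆ r)

  -- A pair in the hole is covered by the two copies of the large block and, by `avoid`, by no
  -- triple. Any other pair is not in the large block and lies in the two triples that `two`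
  -- provides.
  pairs : ∀ r x y → x ≢ y → Dec (On (hole r) x × On (hole r) y) → pairCount x y (ℬ r) ≡ 2
  pairs r x y x≢y hole? = case hole? of λ
    { (yes (onx , ony)) → begin
        pairCount x y (ℬ r)         ≡⟨ count-accept both? (On⇒∈ onx , On⇒∈ ony) _ ⟩
        1 + pairCount x y (_ ∷ triples r) ≡⟨ cong suc (count-accept both? (On⇒∈ onx , On⇒∈ ony) _) ⟩
        2 + pairCount x y (triples r)     ≡⟨ cong (2 +_) (count-filter both? (isTriple? r) (subsets v)) ⟩
        2 + count all? (subsets v)
          ≡⟨ cong (2 +_) (count-none all? (subsets v)
               λ { B ((x∈ , y∈) , t) → avoid onx ony (proj₂ (proj₂ (second t x∈ y∈ x≢y))) }) ⟩
        2                                 ∎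
    ; (no ¬on) → begin
        pairCount x y (ℬ r)               ≡⟨ count-reject both? (λ { (x∈ , y∈) → ¬on (∈⇒On x∈ , ∈⇒On y∈) }) _ ⟩
        pairCount x y (_ ∷ triples r)     ≡⟨ count-reject both? (λ { (x∈ , y∈) → ¬on (∈⇒On x∈ , ∈⇒On y∈) }) _ ⟩
        pairCount x y (triples r)         ≡⟨ count-filter both? (isTriple? r) (subsets v) ⟩
        count all? (subsets v)            ≡⟨ count-two all? (through (two x≢y ¬on)) ⟩
        2                                 ∎
    }
    where
    open ≡-Reasoning
    both? = λ B → (x ∈? B) ×-dec (y ∈? B)
    all?  = λ B → both? B ×-dec isTriple? r B
    through : Two (T r x y) → Two (λ B → (x ∈ B × y ∈ B) × IsTriple r B)
    through (a , b , a≢b , ta , tb , complete) =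
      triple x y a , triple x y b , differ ,
      ((∈-triple₁ x y a , ∈-triple₂ x y a) , x , y , a , refl , ta) ,
      ((∈-triple₁ x y b , ∈-triple₂ x y b) , x , y , b , refl , tb) ,
      λ { B ((x∈ , y∈) , t) → case second t x∈ y∈ x≢y of λ
          { (c , refl , tc) → map⊎ (cong (triple x y)) (cong (triple x y)) (complete c tc) } }
      where
      differ : triple x y a ≢ triple x y b
      differ eq with ∈-triple⁻ x y b (subst (a ∈_) eq (∈-triple₃ x y a))
      ... | inj₁ a≡x        = distinct₁₃ ta (sym a≡x)
      ... | inj₂ (inj₁ a≡y) = distinct₂₃ ta (sym a≡y)
      ... | inj₂ (inj₂ a≡b) = a≢b a≡b

  On? : ∀ l x → Dec (On l x)
  On? l x = map′ ∈⇒On On⇒∈ (x ∈? big l)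

  isLSStar : ∀ {K} → 3 ∈ₗ K → (2 + 2 * d) ∈ₗ K → IsLSStar 2 K v m ℬ
  isLSStar {K} 3∈K h∈K =
    ( (λ r → (λ B B∈ → size (∈ℬ⁻ B∈)) , λ x y x≢y → pairs r x y x≢y (On? (hole r) x ×-dec On? (hole r) y))
    , (λ x y z x≢y x≢z y≢z → exists x≢y x≢z y≢z , λ B B′ → unique x≢y x≢z y≢z)
    , total-mult )
    , λ r B B∈ 4≤ → repeated (∈ℬ⁻ B∈) 4≤
    where
    size : ∀ {r B} → B ≡ big (hole r) ⊎ IsTriple r B → ∣ B ∣ ∈ₗ K
    size (inj₁ refl) = subst (_∈ₗ K) (sym (∣big∣ _)) h∈K
    size (inj₂ t)    = subst (_∈ₗ K) (sym (∣IsTriple∣ t)) 3∈K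
    repeated : ∀ {r B} → B ≡ big (hole r) ⊎ IsTriple r B → 4 ≤ ∣ B ∣ → mult B (ℬ r) ≡ 2
    repeated (inj₁ refl) _  = mult-big _
    repeated (inj₂ t)    4≤ = ⊥-elim (ℕₚ.<-irrefl refl (subst (4 ≤_) (∣IsTriple∣ t) 4≤))
    exists : ∀ {x y z} → x ≢ y → x ≢ z → y ≢ z → ∃ λ B → InUnion ℬ B × x ∈ B × y ∈ B × z ∈ B
    exists {x} {y} {z} x≢y x≢z y≢z with total x≢y x≢z y≢z
    ... | inj₁ (l , onx , ony , onz) = big l , ∈ℬ-big l , On⇒∈ onx , On⇒∈ ony , On⇒∈ onz
    ... | inj₂ (r , t)               = triple x y z , (r , ∈ℬ-triple (x , y , z , refl , t)) ,
                                       ∈-triple₁ x y z , ∈-triple₂ x y z , ∈-triple₃ x y z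
    unique : ∀ {x y z B B′} → x ≢ y → x ≢ z → y ≢ z → InUnion ℬ B → x ∈ B → y ∈ B → z ∈ B →
             InUnion ℬ B′ → x ∈ B′ → y ∈ B′ → z ∈ B′ → B ≡ B′
    unique x≢y x≢z y≢z (r , B∈) x∈ y∈ z∈ (r′ , B′∈) x∈′ y∈′ z∈′ with ∈ℬ⁻ B∈ | ∈ℬ⁻ B′∈
    ... | inj₁ refl | inj₁ refl = cong big
      (big-unique x≢y x≢z y≢z (∈⇒On x∈) (∈⇒On y∈) (∈⇒On z∈) (∈⇒On x∈′) (∈⇒On y∈′) (∈⇒On z∈′))
    ... | inj₁ refl | inj₂ t′   = ⊥-elim
      (transversal (proj₂ (third t′ x∈′ y∈′ z∈′ x≢y x≢z y≢z)) (_ , ∈⇒On x∈ , ∈⇒On y∈ , ∈⇒On z∈))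
    ... | inj₂ t    | inj₁ refl = ⊥-elim
      (transversal (proj₂ (third t x∈ y∈ z∈ x≢y x≢z y≢z)) (_ , ∈⇒On x∈′ , ∈⇒On y∈′ , ∈⇒On z∈′))
    ... | inj₂ t    | inj₂ t′   =
      trans (proj₁ (third t x∈ y∈ z∈ x≢y x≢z y≢z)) (sym (proj₁ (third t′ x∈′ y∈′ z∈′ x≢y x≢z y≢z)))

-- Operations on the number of groups.

Fin-cong : ∀ {m n} → m ≡ n → Fin m ↔ Fin n
Fin-cong refl = ↔-refl

precedes : ∀ {q} → Fin q → Fin q → Bool
precedes i j = toℕ i ℕ.<ᵇ toℕ j

<ᵇ-anti : ∀ {m n} → m ≢ n → (n ℕ.<ᵇ m) ≡ not (m ℕ.<ᵇ n)
<ᵇ-anti {zero}  {zero}  m≢n = ⊥-elim (m≢n refl)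
<ᵇ-anti {zero}  {suc n} m≢n = refl
<ᵇ-anti {suc m} {zero}  m≢n = refl
<ᵇ-anti {suc m} {suc n} m≢n = <ᵇ-anti (m≢n ∘ cong suc)

-- There are n groups of 2d points, with d systems for each group.
Partitioned : ℕ → ℕ → Set₁
Partitioned d n = HoleSystem (On (proj₁ {A = Fin n} {B = λ _ → Fin (2 * d)})) (proj₁ {A = Fin n} {B = λ _ → Fin d})

module _ {q p k : ℕ} .{{_ : NonZero k}} {N W D : Set} {line : N → Fin q}
  (C : DoubleCube line) (_≟ⁿ_ : (x y : N) → Dec (x ≡ y))
  (β : N ↔ (Fin q × Fin p)) (line-β : ∀ x → line (Inverse.from β x) ≡ proj₁ x)
  (ω : W ↔ ((Fin p × Bool) × Fin k)) (δ : D ↔ (Fin p × Fin k)) where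

  private
    φ : (Fin q × W) ↔ ((N × Bool) × Fin k)
    φ = ↔-trans (↔-refl ×-↔ ω) (↔-trans (↔-sym (×-assoc _ _ _ _))
          ((↔-trans (↔-sym (×-assoc _ _ _ _)) (↔-sym β ×-↔ ↔-refl)) ×-↔ ↔-refl))

    ψ : (Fin q × D) ↔ (N × Fin k)
    ψ = ↔-trans (↔-refl ×-↔ δ) (↔-trans (↔-sym (×-assoc _ _ _ _)) (↔-sym β ×-↔ ↔-refl))

  -- The inflated cube in the coordinates (group, position). A line of the small cube has p points,
  -- so a group gets 2pk points, the elements of `W`, and pk systems, the elements of `D`.
  outer : HoleSystem (On (proj₁ {A = Fin q} {B = λ _ → W})) (proj₁ {A = Fin q} {B = λ _ → D})
  outer = transport (↔-refl ⊎-↔ φ) ψ ↔-refl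
    (λ { {_} {∞ _} _ → tt ; {_} {pt v} on → trans (line-β _) on })
    (λ { {_} {∞ _} _ → tt ; {_} {pt v} on → trans (sym (line-β _)) on })
    (λ r → line-β _)
    (holeSystem _≟ᶠ_ (≡-dec (≡-dec _≟ⁿ_ _≟ᵇ_) _≟ᶠ_) (≡-dec _≟ⁿ_ _≟ᶠ_)
      (inflate precedes (λ l≢ → <ᵇ-anti (l≢ ∘ toℕ-injective)) C k))

W-bijection : ∀ {n w p k} → n * w ≡ p * 2 * k → (Fin n × Fin w) ↔ ((Fin p × Bool) × Fin k)
W-bijection eq = ↔-trans (↔-sym *↔×) (↔-trans (Fin-cong eq) (↔-trans *↔× (↔-trans *↔× (↔-refl ×-↔ 2↔Bool) ×-↔ ↔-refl)))

D-bijection : ∀ {n d p k} → n * d ≡ p * k → (Fin n × Fin d) ↔ (Fin p × Fin k)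
D-bijection eq = ↔-trans (↔-sym *↔×) (↔-trans (Fin-cong eq) *↔×)

-- `compose` refines each of the q large groups into n groups of 2d points; the rest is
-- associativity of products.
multiply : ∀ {q n d} →
           HoleSystem (On (proj₁ {A = Fin q} {B = λ _ → Fin n × Fin (2 * d)}))
                      (proj₁ {A = Fin q} {B = λ _ → Fin n × Fin d}) →
           Partitioned d n → Partitioned d (q * n)
multiply {q} {n} {d} H₁ H₂ = transport (↔-refl ⊎-↔ regroup) regroup *↔×
  (λ { {_} {∞ _} _ → tt ; {_} {pt _} refl → refl })
  (λ { {_} {∞ _} _ → tt ; {l} {pt v} on → remQuot-injective on })
  (λ _ → refl)
  (compose _≟ᶠ_ H₁ H₂)
  where
  regroup : ∀ {A : Set} → (Fin (q * n) × A) ↔ (Fin q × (Fin n × A))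
  regroup = ↔-trans (*↔× ×-↔ ↔-refl) (×-assoc _ _ _ _)
  remQuot-injective : ∀ {i j : Fin (q * n)} → remQuot {q} n i ≡ remQuot n j → i ≡ j
  remQuot-injective = to-injective (*↔× {q} {n})

-- All points lie in the only large block, so there is no triple to distribute.
one-group : ∀ d → Partitioned d 1
one-group d = record
  { T           = λ _ _ _ _ → ⊥
  ; T?          = λ _ _ _ _ → no id
  ; swap₁₂      = id
  ; swap₂₃      = id
  ; distinct    = ⊥-elim
  ; transversal = ⊥-elim
  ; functional  = ⊥-elim
  ; total       = λ {x} {y} {z} _ _ _ → inj₁ (zero , on x , on y , on z)
  ; avoid       = λ _ _ ()
  ; two         = λ { {zero , _} {x} {y} _ ¬on → ⊥-elim (¬on (on x , on y)) }
  }
  where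
  on : ∀ x → On (proj₁ {A = Fin 1} {B = λ _ → Fin (2 * d)}) zero x
  on (∞ _)           = tt
  on (pt (zero , _)) = refl

module _ (d n : ℕ) .{{_ : NonZero d}} .{{_ : NonZero n}} where

  private
    instance
      nd-nonZero : NonZero (n * d)
      nd-nonZero = ℕₚ.m*n≢0 n d

    ×1 : ∀ {q} → Fin q ↔ (Fin q × Fin 1)
    ×1 = mk↔ₛ′ (_, zero) proj₁ (λ { (_ , zero) → refl }) (λ _ → refl)

    n*2d : n * (2 * d) ≡ 1 * 2 * (n * d)
    n*2d = lemma n d
      where
      lemma : ∀ n d → n * (2 * d) ≡ 1 * 2 * (n * d)
      lemma = solve-∀

    -- Lines of one point: p is 1 and k is nd, so that each point of the small cube is inflated to a
    -- group of n times 2d points.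
    linear : ∀ {q} → DoubleCube {Fin q} id → Partitioned d n → Partitioned d (q * n)
    linear C = multiply (outer C _≟ᶠ_ ×1 (λ _ → refl) (W-bijection n*2d) (D-bijection (sym (ℕₚ.*-identityˡ (n * d)))))

  quadruple : Partitioned d n → Partitioned d (4 * n)
  quadruple = linear fourCube

  coprime-multiple : ∀ m .{{_ : NonZero m}} → ∀ u w →
                     Modulo._≈_ m (u ℤ.* ℤ.+ 3) (ℤ.+ 1) → Modulo._≈_ m (w ℤ.* ℤ.+ 2) (ℤ.+ 1) →
                     Partitioned d n → Partitioned d (m * n)
  coprime-multiple m u w 3u≈1 2w≈1 = linear (double (averageCube m u w 3u≈1 2w≈1))

  -- The lines of the cube on nine points have three points each, so nd must equal 3k; the factor 3
  -- of `d` provides k = ne.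
  triple-up : ∀ {e} → d ≡ 3 * e → Partitioned d n → Partitioned d (3 * n)
  triple-up {e} d≡3e = multiply (outer {k = n * e} (double nineCube) _≟₉_ ↔-refl (λ _ → refl)
      (W-bijection (trans (cong (λ d → n * (2 * d)) d≡3e) (w-card n e)))
      (D-bijection (trans (cong (n *_) d≡3e) (d-card n e))))
    where
    instance
      ne-nonZero : NonZero (n * e)
      ne-nonZero = ℕₚ.m*n≢0 n e {{it}} {{ℕₚ.m*n≢0⇒n≢0 3 {{subst NonZero d≡3e it}}}}
    w-card : ∀ n e → n * (2 * (3 * e)) ≡ 3 * 2 * (n * e)
    w-card = solve-∀
    d-card : ∀ n e → n * (3 * e) ≡ 3 * (n * e)
    d-card = solve-∀

-- Numbering of the points and systems.

toLSStar : ∀ {d n K} .{{_ : NonZero d}} → 3 ∈ₗ K → 2 + 2 * d ∈ₗ K → Partitioned d n → LSStar 2 K (2 + n * (2 * d))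
toLSStar {d@(suc _)} {n} {K} 3∈K h∈K P = n * d , LS.ℬ , LS.isLSStar 3∈K h∈K
  where
  w = 2 * d

  φ : Fin (2 + n * w) ↔ Pt (Fin n × Fin w)
  φ = ↔-trans +↔⊎ (2↔Bool ⊎-↔ *↔×)

  γ : Fin (2 + w) ↔ Pt (Fin w)
  γ = ↔-trans +↔⊎ (2↔Bool ⊎-↔ ↔-refl)

  module φ = Inverse φ
  module γ = Inverse γ

  On′ : Fin n → Fin (2 + n * w) → Set
  On′ l x = On proj₁ l (φ.to x)

  H : HoleSystem On′ (proj₁ ∘ remQuot {n} d)
  H = transport φ *↔× ↔-refl id id (λ _ → refl) P

  in-group : Fin n → Pt (Fin w) → Pt (Fin n × Fin w)
  in-group l = map⊎ id (l ,_)

  in-group-injective : ∀ {l x y} → in-group l x ≡ in-group l y → x ≡ y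
  in-group-injective {x = ∞ _}  {∞ _}  refl = refl
  in-group-injective {x = pt _} {pt _} refl = refl

  in-group⁻ : ∀ {l} x → On proj₁ l x → ∃ λ y → in-group l y ≡ x
  in-group⁻ (∞ b)        _    = ∞ b , refl
  in-group⁻ (pt (_ , i)) refl = pt i , refl

  in-group⁺ : ∀ l y → On proj₁ l (in-group l y)
  in-group⁺ l (∞ _)  = tt
  in-group⁺ l (pt _) = refl

  block : Fin n → Fin (2 + w) → Fin (2 + n * w)
  block l i = φ.from (in-group l (γ.to i))

  On⇒block : ∀ {l x} → On′ l x → ∃ λ i → block l i ≡ x
  On⇒block {l} {x} on with y , eq ← in-group⁻ (φ.to x) on =
    γ.from y , trans (cong (φ.from ∘ in-group l) (γ.strictlyInverseˡ y)) (trans (cong φ.from eq) (φ.strictlyInverseʳ x))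

  -- Only two points are at infinity, so one of three distinct points is finite and determines the
  -- group.
  same-group : ∀ {l l′} x y z → x ≢ y → x ≢ z → y ≢ z → On proj₁ l x → On proj₁ l y → On proj₁ l z →
               On {V = Fin n × Fin w} proj₁ l′ x → On proj₁ l′ y → On proj₁ l′ z → l ≡ l′
  same-group (pt _) _      _      _ _ _ refl _ _ refl _ _ = refl
  same-group (∞ _)  (pt _) _      _ _ _ _ refl _ _ refl _ = refl
  same-group (∞ _)  (∞ _)  (pt _) _ _ _ _ _ refl _ _ refl = refl
  same-group (∞ _)  (∞ _)  (∞ _)  a b c _ _ _ _ _ _ = ⊥-elim (bool-pigeonhole (a ∘ cong ∞) (b ∘ cong ∞) (c ∘ cong ∞))

  module LS = LargeSet {d = d} H _≟ᶠ_ block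
    (λ eq → to-injective γ (in-group-injective (to-injective (↔-sym φ) eq)))
    On⇒block
    (λ l i → subst (On proj₁ l) (sym (φ.strictlyInverseˡ _)) (in-group⁺ l (γ.to i)))
    combine (λ {l} {i} {j} → combine-injectiveʳ l i l j)
    (λ r → proj₂ (remQuot {n} d r) , combine-remQuot {n} d r)
    (λ l i → cong proj₁ (remQuot-combine l i))
    zero
    (λ {_} {_} {x} {y} {z} x≢y x≢z y≢z → same-group (φ.to x) (φ.to y) (φ.to z)
      (x≢y ∘ to-injective φ) (x≢z ∘ to-injective φ) (y≢z ∘ to-injective φ))

-- Attainable numbers of groups, and the theorem.

halve-even : ∀ n → odd n ≡ false → n ≡ 2 * ⌊ n /2⌋
halve-even n even = trans (sym (bit-odd n)) (cong (λ b → bit b + 2 * ⌊ n /2⌋) even)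

odd-factor : ∀ a b → odd (a * b) ≡ true → odd b ≡ true
odd-factor a b odd-ab with odd b in b-even
... | true  = refl
... | false = trans (sym (odd-bit false (a * ⌊ b /2⌋))) (trans (cong odd (sym even)) odd-ab)
  where
  swap : ∀ a h → a * (2 * h) ≡ 2 * (a * h)
  swap = solve-∀
  even : a * b ≡ 2 * (a * ⌊ b /2⌋)
  even = trans (cong (a *_) (halve-even b b-even)) (swap a ⌊ b /2⌋)

-- Strong induction on `n`. If 3 does not divide `n`, then `n` is coprime to 6 and a single
-- averaging cube on ℤₙ produces all the groups at once. If n = 3m, the cube on nine points reduces
-- the claim to the smaller odd number m.
odd-partitioned : ∀ e .{{_ : NonZero e}} n → odd n ≡ true → Partitioned (3 * e) n
odd-partitioned e@(suc _) = <-rec _ step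
  where
  step : ∀ n → (∀ {m} → m < n → odd m ≡ true → Partitioned (3 * e) m) → odd n ≡ true → Partitioned (3 * e) n
  step n@(suc _) rec n-odd = by-residue (n % 3) (m≡m%n+[m/n]*n n 3) (m%n<n n 3)
    where
    open Modulo n
    j = n / 3
    h = ⌊ n /2⌋

    -- As n = 1 + 2h, twice h + 1 is n + 1, so `suc h` is an inverse of 2.
    2w≈1 : ℤ.+ suc h ℤ.* ℤ.+ 2 ≈ ℤ.+ 1
    2w≈1 = by (ℤ.+ 1) (trans (sym (ℤₚ.pos-* (suc h) 2)) (trans (cong ℤ.+_ (trans (lemma h) (cong suc n≡)))
                        (trans (ℤₚ.pos-+ 1 n) (cong (ℤ._+_ (ℤ.+ 1)) (sym (ℤₚ.*-identityˡ (ℤ.+ n)))))))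
      where
      n≡ : 1 + 2 * h ≡ n
      n≡ = trans (cong (λ b → bit b + 2 * h) (sym n-odd)) (bit-odd n)
      lemma : ∀ h → suc h * 2 ≡ suc (1 + 2 * h)
      lemma = solve-∀

    coprime : ∀ u a → u * 3 ≡ 1 + a * n → Partitioned (3 * e) n
    coprime u a eq = subst (Partitioned (3 * e)) (ℕₚ.*-identityʳ n)
      (coprime-multiple (3 * e) 1 n (ℤ.+ u) (ℤ.+ suc h) 3u≈1 2w≈1 (one-group (3 * e)))
      where
      3u≈1 : ℤ.+ u ℤ.* ℤ.+ 3 ≈ ℤ.+ 1
      3u≈1 = by (ℤ.+ a) (trans (sym (ℤₚ.pos-* u 3)) (trans (cong ℤ.+_ eq)
                          (trans (ℤₚ.pos-+ 1 (a * n)) (cong (ℤ._+_ (ℤ.+ 1)) (ℤₚ.pos-* a n)))))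

    third : ∀ m → n ≡ 3 * m → Partitioned (3 * e) n
    third zero ()
    third m@(suc _) eq = subst (Partitioned (3 * e)) (sym eq)
      (triple-up (3 * e) m {e} refl (rec (subst (m <_) (sym eq) (ℕₚ.m<m+n m (s≤s ℕ.z≤n)))
                                         (odd-factor 3 m (subst (λ x → odd x ≡ true) eq n-odd))))

    by-residue : ∀ r → n ≡ r + j * 3 → r < 3 → Partitioned (3 * e) n
    by-residue 0 eq _ = third j (trans eq (ℕₚ.*-comm j 3))
    -- For n = 1 + 3j the inverse of 3 comes from 3(1 + 2j) = 1 + 2n.
    by-residue 1 eq _ = coprime (1 + 2 * j) 2 (trans (lemma j) (cong (λ x → 1 + 2 * x) (sym eq)))
      where
      lemma : ∀ j → (1 + 2 * j) * 3 ≡ 1 + 2 * (1 + j * 3)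
      lemma = solve-∀
    -- For n = 2 + 3j the inverse of 3 comes from 3(1 + j) = 1 + n.
    by-residue 2 eq _ = coprime (1 + j) 1 (trans (lemma j) (cong (λ x → 1 + 1 * x) (sym eq)))
      where
      lemma : ∀ j → (1 + j) * 3 ≡ 1 + 1 * (2 + j * 3)
      lemma = solve-∀
    by-residue (suc (suc (suc _))) _ (s≤s (s≤s (s≤s ())))

-- The cube on 𝔽₄ removes factors of 4 until `n` is odd or twice an odd number. An odd number of
-- groups of 12 points is available directly; in the other case the groups are merged in pairs,
-- leaving an odd number of groups of 24 points.
partitioned-6-12 : ∀ n .{{_ : NonZero n}} → Partitioned 6 n ⊎ ∃ λ m → n ≡ 2 * m × Partitioned 12 m
partitioned-6-12 n@(suc _) = <-rec Claim step n {{_}}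
  where
  Claim : ℕ → Set₁
  Claim n = .{{_ : NonZero n}} → Partitioned 6 n ⊎ ∃ λ m → n ≡ 2 * m × Partitioned 12 m
  step : ∀ n → (∀ {m} → m < n → Claim m) → Claim n
  step n@(suc _) rec with odd n in n-odd | odd ⌊ n /2⌋ in h-odd
  ... | true  | _     = inj₁ (odd-partitioned 2 n n-odd)
  ... | false | true  = inj₂ (⌊ n /2⌋ , halve-even n n-odd , odd-partitioned 4 ⌊ n /2⌋ h-odd)
  ... | false | false = quarter ⌊ ⌊ n /2⌋ /2⌋
    (trans (halve-even n n-odd)
           (trans (cong (2 *_) (halve-even ⌊ n /2⌋ h-odd)) (sym (ℕₚ.*-assoc 2 2 ⌊ ⌊ n /2⌋ /2⌋))))
    where
    quarter : ∀ m → n ≡ 4 * m → Partitioned 6 n ⊎ ∃ λ m → n ≡ 2 * m × Partitioned 12 m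
    quarter zero ()
    quarter m@(suc _) eq with rec (subst (m <_) (sym eq) (ℕₚ.m<m+n m (s≤s ℕ.z≤n)))
    ... | inj₁ P = inj₁ (subst (Partitioned 6) (sym eq) (quadruple 6 m P))
    ... | inj₂ (zero , () , _)
    ... | inj₂ (m′@(suc _) , m≡ , P) = inj₂ (4 * m′ , trans eq (trans (cong (4 *_) m≡) (lemma m′)) , quadruple 12 m′ P)
      where
      lemma : ∀ m → 4 * (2 * m) ≡ 2 * (4 * m)
      lemma = solve-∀

-- Two points have no 3-subset to cover, so the empty family of systems is an LS*.
LSStar-2 : ∀ {K} → LSStar 2 K 2
LSStar-2 = 0 , (λ ()) ,
  ((λ ()) , (λ x y z x≢y x≢z y≢z → ⊥-elim (none x y z x≢y x≢z y≢z)) , λ { B (() , _) }) , λ ()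
  where
  none : (x y z : Fin 2) → x ≢ y → x ≢ z → y ≢ z → ⊥
  none x y z x≢y x≢z y≢z = bool-pigeonhole (x≢y ∘ to-injective 2↔Bool) (x≢z ∘ to-injective 2↔Bool)
                                           (y≢z ∘ to-injective 2↔Bool)

theorem2p11 : (∀ (v : ℕ) → v % 12 ≡ 8 → LSStar 2 (3 ∷ 8 ∷ []) v)
    × (∀ (v : ℕ) → v % 12 ≡ 2 → LSStar 2 (3 ∷ 14 ∷ 26 ∷ 50 ∷ 98 ∷ []) v)
theorem2p11 = eight , two-mod
  where
  eight : ∀ (v : ℕ) → v % 12 ≡ 8 → LSStar 2 (3 ∷ 8 ∷ []) v
  -- Here v = 8 + 12j is 2 + 6(1 + 2j): an odd number of groups of 6 points, with large blocks of
  -- size 8.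
  eight v v≡8 = subst (LSStar 2 _) (sym v≡)
    (toLSStar (here refl) (there (here refl)) (odd-partitioned 1 (1 + 2 * j) (odd-bit true j)))
    where
    j = v / 12
    lemma : ∀ j → 8 + j * 12 ≡ 2 + (1 + 2 * j) * 6
    lemma = solve-∀
    v≡ : v ≡ 2 + (1 + 2 * j) * 6
    v≡ = trans (m≡m%n+[m/n]*n v 12) (trans (cong (_+ j * 12) v≡8) (lemma j))

  two-mod : ∀ (v : ℕ) → v % 12 ≡ 2 → LSStar 2 (3 ∷ 14 ∷ 26 ∷ 50 ∷ 98 ∷ []) v
  two-mod v v≡2 = subst (LSStar 2 _) (sym (trans (m≡m%n+[m/n]*n v 12) (cong (_+ v / 12 * 12) v≡2))) (main (v / 12))
    where
    lemma : ∀ m → 2 + m * 24 ≡ 2 + 2 * m * 12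
    lemma = solve-∀
    main : ∀ n → LSStar 2 (3 ∷ 14 ∷ 26 ∷ 50 ∷ 98 ∷ []) (2 + n * 12)
    main zero      = LSStar-2
    main n@(suc _) with partitioned-6-12 n
    -- Groups of 12 points give large blocks of size 14, and in the next case groups of 24 points
    -- give size 26.
    ... | inj₁ P              = toLSStar (here refl) (there (here refl)) P
    ... | inj₂ (m , n≡2m , P) = subst (LSStar 2 _) (trans (lemma m) (cong (λ n → 2 + n * 12) (sym n≡2m)))
                                      (toLSStar (here refl) (there (there (here refl))) P)
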